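{- Let $a\in\mathbb{Z}$ and let $\alpha$ be a root of $X^3-(a-1)X^2-(a+2)X-1$. Then $\omega(\mathbb{Z}[\alpha])\leq 2$, i.e. every nonzero element of $\mathbb{Z}[\alpha]$ can be written as $a_1\nu_1+\dots+a_\ell\nu_\ell$ with pairwise distinct units $\nu_1,\dots,\nu_\ell\in\mathbb{Z}[\alpha]^*$ and coefficients $a_i\in\{1,2\}$.
   Context: For an order $\mathcal{O}$ of a number field, $\omega(\mathcal{O})$ denotes $\omega_{\mathcal{O}^*}(\mathcal{O})$, where for a subring $R$ of a field $F$ of characteristic $0$ and a finitely generated subgroup $\Gamma\subset F^*$: $\omega_{R,\Gamma}(\alpha)$ is the least $a_1$ over all representations $\alpha=a_1\nu_1+\dots+a_\ell\nu_\ell$ with pairwise distinct $\nu_i\in\Gamma\cap R$ and integers $a_1\geq\dots\geq a_\ell>0$ ($\omega_{R,\Gamma}(0)=0$, and $\infty$ if no representation exists), and $\omega_\Gamma(R)=\max_{\alpha\in R}\omega_{R,\Gamma}(\alpha)$ when the maximum exists. -}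

module Defs where

open import Algebra.Apartness.Bundles using (HeytingField; HeytingCommutativeRing)
open import Algebra.Bundles using (CommutativeRing; Semiring)
import Algebra.Definitions.RawSemiring as RawSemiringDefinitions
import Data.Fin.Base as Fin
open import Data.Integer.Base as ℤ using (ℤ; +_; -[1+_])
open import Data.Nat.Base as ℕ using (ℕ; suc; NonZero)
open import Data.Product.Base using (∃; _×_)
open import Data.Vec.Functional using (Vector)
open import Level using (Level; _⊔_)
open import Relation.Binary.Construct.Add.Supremum.NonStrict ℕ._≤_ using (_≤⁺_)
open import Relation.Binary.Definitions using (Antitonic₁)
open import Relation.Binary.PropositionalEquality.Core using (_≡_; _≢_)
open import Relation.Nullary.Construct.Add.Supremum using (_⁺; ⊤⁺; [_])
open import Relation.Nullary.Negation.Core using (¬_)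
open import Relation.Unary using (Pred; _∈_)

module _ {c ℓ₁ ℓ₂ : Level} (F : HeytingField c ℓ₁ ℓ₂) where

  open CommutativeRing
    (HeytingCommutativeRing.commutativeRing (HeytingField.heytingCommutativeRing F))
  open RawSemiringDefinitions (Semiring.rawSemiring semiring) using (sum; _^_)
    renaming (_×_ to infixr 8 _·_)

  CharacteristicZero : Set ℓ₁
  CharacteristicZero = ∀ (n : ℕ) .{{_ : NonZero n}} → n · 1# ≉ 0#

  infixr 8 _ℤ·_
  _ℤ·_ : ℤ → Carrier → Carrier
  (+ n)    ℤ· x = n · x
  -[1+ n ] ℤ· x = - (suc n · x)

  IsRoot : ℤ → Carrier → Set ℓ₁
  IsRoot a α =
    α ^ 3 - (a ℤ.- + 1) ℤ· α ^ 2 - (a ℤ.+ + 2) ℤ· α - 1# ≈ 0#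

  -- The subring of F generated by α; `resp-≈` makes it a predicate on the
  -- setoid (Carrier, _≈_).
  data ℤ[_] (α : Carrier) : Pred Carrier (c ⊔ ℓ₁) where
    generator : α ∈ ℤ[ α ]
    1#-mem    : 1# ∈ ℤ[ α ]
    +-closed  : ∀ {x y} → x ∈ ℤ[ α ] → y ∈ ℤ[ α ] → x + y ∈ ℤ[ α ]
    *-closed  : ∀ {x y} → x ∈ ℤ[ α ] → y ∈ ℤ[ α ] → x * y ∈ ℤ[ α ]
    -‿closed  : ∀ {x} → x ∈ ℤ[ α ] → - x ∈ ℤ[ α ]
    resp-≈    : ∀ {x y} → x ≈ y → x ∈ ℤ[ α ] → y ∈ ℤ[ α ]

  Units : ∀ {r} → Pred Carrier r → Pred Carrier (c ⊔ ℓ₁ ⊔ r)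
  Units R u = u ∈ R × ∃ λ v → v ∈ R × u * v ≈ 1#

  module _ {r g : Level} (R : Pred Carrier r) (Γ : Pred Carrier g) where

    record Representation (x : Carrier) : Set (c ⊔ ℓ₁ ⊔ r ⊔ g) where
      field
        ℓ-1        : ℕ
        coeff      : Vector ℕ (suc ℓ-1)
        ν          : Vector Carrier (suc ℓ-1)
        positive   : ∀ i → 0 ℕ.< coeff i
        decreasing : Antitonic₁ Fin._≤_ ℕ._≤_ coeff
        ν∈Γ        : ∀ i → ν i ∈ Γ
        ν∈R        : ∀ i → ν i ∈ R
        distinct   : ∀ {i j} → i ≢ j → ν i ≉ ν j
        equation   : x ≈ sum (λ i → coeff i · ν i)

      leading : ℕ
      leading = coeff Fin.zero

    open Representation public

    -- The graph of x ↦ ω_{R,Γ}(x) ∈ ℕ ∪ {∞}. It is a relation because the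
    -- least leading coefficient need not be computable.
    data Omega (x : Carrier) : ℕ ⁺ → Set (c ⊔ ℓ₁ ⊔ r ⊔ g) where
      at-zero  : x ≈ 0# → Omega x [ 0 ]
      finite   : ∀ {n} → x ≉ 0# →
                 (∃ λ (ρ : Representation x) → leading ρ ≡ n) →
                 (∀ (ρ : Representation x) → n ℕ.≤ leading ρ) →
                 Omega x [ n ]
      infinite : x ≉ 0# → ¬ Representation x → Omega x ⊤⁺

    -- m is the maximum of ω_{R,Γ} over R, i.e. ω_Γ(R) exists and equals m.
    IsOmega : ℕ → Set (c ⊔ ℓ₁ ⊔ r ⊔ g)
    IsOmega m =
      (∃ λ x → x ∈ R × Omega x [ m ]) ×
      (∀ {x} → x ∈ R → ∀ {v} → Omega x v → v ≤⁺ [ m ])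

  IsOmegaOfOrder : ∀ {r} → Pred Carrier r → ℕ → Set (c ⊔ ℓ₁ ⊔ r)
  IsOmegaOfOrder R = IsOmega R (Units R)

  RepresentationByUnits : ∀ {r} → Pred Carrier r → Carrier → Set (c ⊔ ℓ₁ ⊔ r)
  RepresentationByUnits R = Representation R (Units R)

{-# OPTIONS --safe #-}

-- Put γ = −1 − α, so that 1 + α + γ = 0 and α, γ are units.  Since
-- x³ + y³ + z³ = 3xyz whenever x + y + z = 0,
--   3 = α⁻¹γ⁻¹ + α²γ⁻¹ + α⁻¹γ².
-- Write an element p + qα + rα² as a pile of |p| + |q| + |r| chips on the
-- exponents of ±1, ±α, ±α², a chip on (i , j) standing for ± αⁱγʲ.  The identity
-- replaces three chips on one site by three chips on distinct sites.  Each such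
-- firing increases the sum of the squares of the heights h = ⌊(i − j) / 3⌋ of the
-- chips.  The occupied values of |h| always form an initial segment of ℕ, hence
-- stay below the number of chips, so firing stops, and then every site carries at
-- most two chips.
--
-- Different sites carry different units because α and γ are multiplicatively
-- independent modulo ±1: none of −1, ±α, ±γ, ±αγ is a square modulo 4, so both
-- exponents of a relation αⁱγʲ = ±1 are even and can be halved.

module Submission where

open import Defs
open import Algebra.Apartness.Bundles using (HeytingField; HeytingCommutativeRing)
open import Algebra.Bundles using (CommutativeRing; Semiring)
import Algebra.Definitions.RawSemiring as RawSemiringDefinitions
import Algebra.Properties.CommutativeSemigroup as CommutativeSemigroup
import Algebra.Properties.Ring as RingProperties
import Algebra.Properties.Semiring.Mult as Mult
import Algebra.Properties.Semiring.Mult.TCOptimised as Mult′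
import Algebra.Solver.Ring as RingSolver
open import Algebra.Solver.Ring.AlmostCommutativeRing
  using (fromCommutativeRing; _-Raw-AlmostCommutative⟶_)
open import Data.Fin.Base as Fin using (Fin; toℕ; zero; suc; fromℕ<)
open import Data.Fin.Patterns using (0F; 1F; 2F; 3F)
import Data.Fin.Properties as Fin
open import Data.Integer.Base as ℤ using (ℤ; +_; -[1+_]; ∣_∣; _◃_; sign)
open import Data.Integer.Divisibility.Signed
  using (_∣_; divides; _∣?_; ∣m∣n⇒∣m+n; ∣m∣n⇒∣m-n; ∣n⇒∣m*n; ∣m⇒∣m*n; ∣m⇒∣-m)
open import Data.Integer.DivMod using (_%ℕ_; _/ℕ_; n%ℕd<d; a≡a%ℕn+[a/ℕn]*n)
import Data.Integer.Properties as ℤ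
open import Data.Integer.Solver using (module +-*-Solver)
open import Data.List.Base using (List; []; _∷_; _++_; length; map; lookup; foldr; replicate)
import Data.List.Membership.DecPropositional as DecMembership
import Data.List.Membership.Propositional as List
open import Data.List.Membership.Propositional.Properties using (∈-++⁻; ∈-lookup)
open import Data.List.Relation.Binary.Permutation.Propositional as Permutation
  using (_↭_; ↭-refl; ↭-sym; ↭-trans; ↭-prep; ↭-swap; ↭⇒↭ₛ)
open import Data.List.Relation.Binary.Permutation.Propositional.Properties
  using (shift; ++⁺; ++⁺ˡ; Any-resp-↭; ↭-length; map⁺)
import Data.List.Relation.Binary.Permutation.Setoid.Properties as SetoidPermutation
open import Data.List.Relation.Unary.All as All using (All; []; _∷_)
import Data.List.Relation.Unary.All.Properties as All
open import Data.List.Relation.Unary.AllPairs as AllPairs using (AllPairs; []; _∷_)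
import Data.List.Relation.Unary.AllPairs.Properties as AllPairs
open import Data.List.Relation.Unary.Any as Any using (Any; here; there)
open import Data.List.Relation.Unary.Any.Properties using (lookup-index)
open import Data.List.Relation.Unary.Unique.Propositional using (Unique)
import Data.Maybe.Base as Maybe
open import Data.Nat.Base as ℕ using (ℕ; zero; suc; z≤n; s≤s; _≤_; NonZero)
import Data.Nat.ListAction as ℕ
open import Data.Nat.ListAction.Properties using (sum-↭)
import Data.Nat.Properties as ℕ
open import Data.Product.Base using (Σ; ∃; ∃₂; _×_; _,_; proj₁; proj₂)
import Data.Product.Properties as Product
open import Data.Sign.Base as Sign using (Sign)
open import Data.Sum.Base using (_⊎_; inj₁; inj₂)
open import Data.Vec.Base as Vec using (Vec; []; _∷_)
open import Data.Vec.Properties using (lookup-map)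
open import Function.Base using (_∘_; case_of_)
open import Level using (Level)
open import Relation.Binary.Construct.Add.Supremum.NonStrict _≤_ using (_≤⁺_; [_])
open import Relation.Binary.Definitions
  using (DecidableEquality; _Respects_; tri<; tri≈; tri>)
open import Relation.Binary.PropositionalEquality as ≡ using (_≡_; _≢_)
open import Relation.Nullary
  using (¬_; Dec; yes; no; contradiction; ¬?; True; toWitness; _×-dec_)
open import Relation.Nullary.Construct.Add.Supremum using ([_])
open import Relation.Nullary.Decidable using (decidable-stable; dec⇒maybe; from-yes; map′)
open import Relation.Unary using (Pred; Decidable; _∈_)

-- Integer polynomials modulo n, decided by enumerating residues

module Congruences where

  open ≡
  open +-*-Solver

  private variable m : ℕ

  *-cong-mod : ∀ k p q r s → k ∣ p ℤ.- r → k ∣ q ℤ.- s → k ∣ p ℤ.* q ℤ.- r ℤ.* s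
  *-cong-mod k p q r s p≡r q≡s =
    subst (k ∣_) (solve 4 (λ p q r s → (p :- r) :* q :+ r :* (q :- s) := (p :* q) :- (r :* s)) refl p q r s)
      (∣m∣n⇒∣m+n (∣m⇒∣m*n q p≡r) (∣n⇒∣m*n r q≡s))

  module _ k {ρ σ : Vec ℤ m} (ρ≡σ : ∀ i → k ∣ Vec.lookup ρ i ℤ.- Vec.lookup σ i) where

    ⟦⟧-cong-mod : ∀ P → k ∣ ⟦ P ⟧ ρ ℤ.- ⟦ P ⟧ σ
    ⟦⟧-cong-mod (op [+] P Q) =
      subst (k ∣_) (solve 4 (λ p q r s → (p :- r) :+ (q :- s) := (p :+ q) :- (r :+ s)) refl
                      (⟦ P ⟧ ρ) (⟦ Q ⟧ ρ) (⟦ P ⟧ σ) (⟦ Q ⟧ σ))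
        (∣m∣n⇒∣m+n (⟦⟧-cong-mod P) (⟦⟧-cong-mod Q))
    ⟦⟧-cong-mod (op [*] P Q) =
      *-cong-mod k (⟦ P ⟧ ρ) (⟦ Q ⟧ ρ) (⟦ P ⟧ σ) (⟦ Q ⟧ σ) (⟦⟧-cong-mod P) (⟦⟧-cong-mod Q)
    ⟦⟧-cong-mod (con c) = divides (+ 0) (ℤ.+-inverseʳ c)
    ⟦⟧-cong-mod (var x) = ρ≡σ x
    ⟦⟧-cong-mod (P :^ zero) = divides (+ 0) refl
    ⟦⟧-cong-mod (P :^ suc n) =
      *-cong-mod k (⟦ P ⟧ ρ) (⟦ P :^ n ⟧ ρ) (⟦ P ⟧ σ) (⟦ P :^ n ⟧ σ) (⟦⟧-cong-mod P) (⟦⟧-cong-mod (P :^ n))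
    ⟦⟧-cong-mod (:- P) =
      subst (k ∣_) (solve 2 (λ p r → :- (p :- r) := (:- p) :- (:- r)) refl (⟦ P ⟧ ρ) (⟦ P ⟧ σ))
        (∣m⇒∣-m (⟦⟧-cong-mod P))

  allVectors? : ∀ {n m p} {P : Pred (Vec (Fin n) m) p} → Decidable P → Dec (∀ v → P v)
  allVectors? {m = zero} P? = map′ (λ { p [] → p }) (λ p → p []) (P? [])
  allVectors? {m = suc m} P? =
    map′ (λ { p (x ∷ v) → p x v }) (λ p x v → p (x ∷ v))
      (Fin.all? λ x → allVectors? λ v → P? (x ∷ v))

  fromResidues : ∀ {n} → Vec (Fin n) m → Vec ℤ m
  fromResidues = Vec.map (λ i → + toℕ i)

  CommonZeroMod : ℕ → List (Polynomial m) → Pred (Vec ℤ m) _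
  CommonZeroMod n Ps ρ = All (λ P → + n ∣ ⟦ P ⟧ ρ) Ps

  noCommonZero? : ∀ n (Ps : List (Polynomial m)) →
    Dec (∀ (v : Vec (Fin n) m) → ¬ CommonZeroMod n Ps (fromResidues v))
  noCommonZero? n Ps = allVectors? λ v → ¬? (All.all? (λ P → + n ∣? ⟦ P ⟧ (fromResidues v)) Ps)

  -- Replacing the entries of `ρ` by their residues modulo `n` preserves the divisibility of every
  -- polynomial value, so a finite check on residues settles all integer vectors. That check is
  -- evaluated by the type checker through the implicit `True` argument.
  noCommonZero : ∀ n .{{_ : NonZero n}} (Ps : List (Polynomial m))
    {_ : True (noCommonZero? n Ps)} → ∀ ρ → ¬ CommonZeroMod n Ps ρ
  noCommonZero n Ps {t} ρ zeros =
    toWitness t residues (All.map (λ {P} → transfer P) zeros)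
    where
    residues = Vec.map (λ x → fromℕ< (n%ℕd<d x n)) ρ
    congruent : ∀ i → + n ∣ Vec.lookup ρ i ℤ.- Vec.lookup (fromResidues residues) i
    congruent i
      rewrite lookup-map i (λ (i : Fin n) → + toℕ i) residues
            | lookup-map i (λ x → fromℕ< (n%ℕd<d x n)) ρ
            | Fin.toℕ-fromℕ< (n%ℕd<d (Vec.lookup ρ i) n) =
      divides (Vec.lookup ρ i /ℕ n) (trans
        (cong (ℤ._- + (Vec.lookup ρ i %ℕ n)) (a≡a%ℕn+[a/ℕn]*n (Vec.lookup ρ i) n))
        (solve 2 (λ r q → (r :+ q) :- r := q) refl (+ (Vec.lookup ρ i %ℕ n)) (Vec.lookup ρ i /ℕ n ℤ.* + n)))
    transfer : ∀ P → + n ∣ ⟦ P ⟧ ρ → + n ∣ ⟦ P ⟧ (fromResidues residues)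
    transfer P d = subst (+ n ∣_)
      (solve 2 (λ p q → p :- (p :- q) := q) refl (⟦ P ⟧ ρ) (⟦ P ⟧ (fromResidues residues)))
      (∣m∣n⇒∣m-n d (⟦⟧-cong-mod (+ n) congruent P))

  2∣n⊎2∣n-1 : ∀ n → (+ 2 ∣ n) ⊎ (+ 2 ∣ n ℤ.- + 1)
  2∣n⊎2∣n-1 n with n %ℕ 2 | n%ℕd<d n 2 | a≡a%ℕn+[a/ℕn]*n n 2
  ... | 0 | _ | eq = inj₁ (divides (n /ℕ 2) (trans eq (ℤ.+-identityˡ _)))
  ... | 1 | _ | eq = inj₂ (divides (n /ℕ 2) (trans (cong (ℤ._- + 1) eq)
    (solve 1 (λ q → (con (+ 1) :+ q) :- con (+ 1) := q) refl (n /ℕ 2 ℤ.* + 2))))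
  ... | suc (suc _) | s≤s (s≤s ()) | _

  -- The summand `+ 0` is kept so that both parities have the shape `i₀ ℤ.+ k ℤ.* + 2` on which
  -- `unit-even` operates.
  parity : ∀ n → (∃ λ k → n ≡ + 0 ℤ.+ k ℤ.* + 2) ⊎ (∃ λ k → n ≡ + 1 ℤ.+ k ℤ.* + 2)
  parity n with 2∣n⊎2∣n-1 n
  ... | inj₁ (divides k eq) = inj₁ (k , trans eq (sym (ℤ.+-identityˡ _)))
  ... | inj₂ (divides k eq) = inj₂ (k , trans
    (solve 1 (λ n → n := con (+ 1) :+ (n :- con (+ 1))) refl n) (cong (ℤ._+_ (+ 1)) eq))

  n*2≡n+n : ∀ n → n ℤ.* + 2 ≡ n ℤ.+ n
  n*2≡n+n = solve 1 (λ n → n :* con (+ 2) := n :+ n) refl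

open Congruences

-- The order in coordinates: norm, units and squares modulo 4

module CubicOrders where

  open ≡
  open +-*-Solver

  -- Coordinates with respect to 1, α, α², where α³ = 1 + d α + b α².
  module Coordinates {A : Set} (_+_ _*_ : A → A → A) (-_ : A → A) (b d : A) where

    record Triple : Set where
      constructor ⟨_,_,_⟩
      field c₀ c₁ c₂ : A
    open Triple public

    infixl 6 _⊕_
    infixr 7 _•_
    infixr 8 α•_

    _⊕_ : Triple → Triple → Triple
    ⟨ p , q , r ⟩ ⊕ ⟨ p′ , q′ , r′ ⟩ = ⟨ p + p′ , q + q′ , r + r′ ⟩

    _•_ : A → Triple → Triple
    n • ⟨ p , q , r ⟩ = ⟨ n * p , n * q , n * r ⟩

    α•_ : Triple → Triple
    α• ⟨ p , q , r ⟩ = ⟨ r , p + (d * r) , q + (b * r) ⟩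

    infixl 7 _⊗_

    _⊗_ : Triple → Triple → Triple
    ⟨ p , q , r ⟩ ⊗ t = p • t ⊕ q • α• t ⊕ r • α• α• t

    -- The cofactors of the first column of the matrix with rows s, α s, α² s.
    adjugate : Triple → Triple
    adjugate s =
      ⟨ (c₁ s₁ * c₂ s₂) + (- (c₂ s₁ * c₁ s₂))
      , (c₂ s  * c₁ s₂) + (- (c₁ s  * c₂ s₂))
      , (c₁ s  * c₂ s₁) + (- (c₂ s  * c₁ s₁)) ⟩
      where
      s₁ = α• s
      s₂ = α• s₁

    -- The determinant of the matrix with rows s, α s, α² s, expanded along its first column. It is
    -- the norm form of the order.
    norm : Triple → A
    norm s = c₀ (adjugate s ⊗ s)

  -- The variables 0F, 1F, 2F, 3F are a and the three coordinates.
  module Generic = Coordinates {Polynomial 4} _:+_ _:*_ :-_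
    (var 0F :- con (+ 1)) (var 0F :+ con (+ 2))

  module CubicOrder (a : ℤ) where

    open Coordinates ℤ._+_ ℤ._*_ ℤ.-_ (a ℤ.- + 1) (a ℤ.+ + 2) public

    -- The product is the combination of s, α s, α² s whose coefficients are the cofactors of the
    -- first column. Its second and third coordinates expand determinants with a repeated column,
    -- hence vanish.
    adjugate-⊗ : ∀ s → adjugate s ⊗ s ≡ ⟨ norm s , + 0 , + 0 ⟩
    adjugate-⊗ s = cong₂ (λ q r → ⟨ norm s , q , r ⟩)
      (solve 6 (λ q r q₁ r₁ q₂ r₂ →
          (q₁ :* r₂ :- r₁ :* q₂) :* q :+ (r :* q₂ :- q :* r₂) :* q₁ :+ (q :* r₁ :- r :* q₁) :* q₂
            := con (+ 0)) refl
        (c₁ s) (c₂ s) (c₁ s₁) (c₂ s₁) (c₁ s₂) (c₂ s₂))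
      (solve 6 (λ q r q₁ r₁ q₂ r₂ →
          (q₁ :* r₂ :- r₁ :* q₂) :* r :+ (r :* q₂ :- q :* r₂) :* r₁ :+ (q :* r₁ :- r :* q₁) :* r₂
            := con (+ 0)) refl
        (c₁ s) (c₂ s) (c₁ s₁) (c₂ s₁) (c₁ s₂) (c₂ s₂))
      where
      s₁ = α• s
      s₂ = α• s₁

    environment : Triple → Vec ℤ 4
    environment ⟨ p , q , r ⟩ = a ∷ p ∷ q ∷ r ∷ []

    -- A triple with indeterminate coordinates. Formulas built from it reduce at `environment s` to
    -- the integer formulas for `s`, so divisibility facts about `s` can be passed to `noCommonZero`
    -- directly.
    generic : Generic.Triple
    generic = Generic.⟨ var 1F , var 2F , var 3F ⟩

    infix 4 _∣³_
    _∣³_ : ℤ → Triple → Set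
    n ∣³ s = (n ∣ c₀ s) × (n ∣ c₁ s) × (n ∣ c₂ s)

    ⟨⟩-cong : ∀ {p q r p′ q′ r′} → p ≡ p′ → q ≡ q′ → r ≡ r′ → ⟨ p , q , r ⟩ ≡ ⟨ p′ , q′ , r′ ⟩
    ⟨⟩-cong refl refl refl = refl

    ∣³⇒• : ∀ {n s} → n ∣³ s → ∃ λ t → s ≡ n • t
    ∣³⇒• {n} (divides p p≡ , divides q q≡ , divides r r≡) =
      ⟨ p , q , r ⟩ , ⟨⟩-cong (trans p≡ (ℤ.*-comm p n)) (trans q≡ (ℤ.*-comm q n)) (trans r≡ (ℤ.*-comm r n))

    -- X³ − (a − 1) X² − (a + 2) X − 1 is irreducible modulo 2.
    2∣norm⇒2∣³ : ∀ s → + 2 ∣ norm s → + 2 ∣³ s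
    2∣norm⇒2∣³ s@(⟨ p , q , r ⟩) 2∣norm =
      even p (λ N o → noCommonZero 2 (Generic.norm generic ∷ var 1F :- con (+ 1) ∷ []) ρ (N ∷ o ∷ [])) ,
      even q (λ N o → noCommonZero 2 (Generic.norm generic ∷ var 2F :- con (+ 1) ∷ []) ρ (N ∷ o ∷ [])) ,
      even r (λ N o → noCommonZero 2 (Generic.norm generic ∷ var 3F :- con (+ 1) ∷ []) ρ (N ∷ o ∷ []))
      where
      ρ = environment s
      even : ∀ n → (+ 2 ∣ norm s → ¬ (+ 2 ∣ n ℤ.- + 1)) → + 2 ∣ n
      even n odd⇒⊥ with 2∣n⊎2∣n-1 n
      ... | inj₁ 2∣n = 2∣n
      ... | inj₂ 2∣n-1 = contradiction 2∣n-1 (odd⇒⊥ 2∣norm)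

    4∣³2•2• : ∀ s → + 4 ∣³ + 2 • + 2 • s
    4∣³2•2• ⟨ p , q , r ⟩ = fourfold p , fourfold q , fourfold r
      where
      fourfold : ∀ n → + 4 ∣ + 2 ℤ.* (+ 2 ℤ.* n)
      fourfold n = divides n (solve 1 (λ n → con (+ 2) :* (con (+ 2) :* n) := n :* con (+ 4)) refl n)

    -- The inverses come from the cubic f. Its constant term -1 gives α (α² - (a - 1) α - (a + 2)) =
    -- 1. Since f(-1) = 1, the polynomial f - 1 factors as (X + 1)(X² - a X - 2), so (-1 - α)(α² - a
    -- α - 2) = 1.
    1̂ α̂ γ̂ αγ̂ α̂⁻¹ γ̂⁻¹ : Triple
    1̂   = ⟨ + 1 , + 0 , + 0 ⟩
    α̂   = ⟨ + 0 , + 1 , + 0 ⟩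
    γ̂   = ⟨ -[1+ 0 ] , -[1+ 0 ] , + 0 ⟩
    αγ̂  = ⟨ + 0 , -[1+ 0 ] , -[1+ 0 ] ⟩
    α̂⁻¹ = ⟨ ℤ.- (a ℤ.+ + 2) , ℤ.- (a ℤ.- + 1) , + 1 ⟩
    γ̂⁻¹ = ⟨ -[1+ 1 ] , ℤ.- a , + 1 ⟩

    γ⊗γ⁻¹≡1 : γ̂ ⊗ γ̂⁻¹ ≡ 1̂
    γ⊗γ⁻¹≡1 = ⟨⟩-cong
      (solve 1 (λ a → let open Symbolic a in G.c₀ product := con (+ 1)) refl a)
      (solve 1 (λ a → let open Symbolic a in G.c₁ product := con (+ 0)) refl a)
      (solve 1 (λ a → let open Symbolic a in G.c₂ product := con (+ 0)) refl a)
      where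
      module Symbolic (a : Polynomial 1) where
        module G = Coordinates {Polynomial 1} _:+_ _:*_ :-_ (a :- con (+ 1)) (a :+ con (+ 2))
        product = G.⟨ con -[1+ 0 ] , con -[1+ 0 ] , con (+ 0) ⟩ G.⊗ G.⟨ con -[1+ 1 ] , :- a , con (+ 1) ⟩

    infixl 6 _⊖_
    _⊖_ : Triple → Triple → Triple
    s ⊖ t = s ⊕ -[1+ 0 ] • t

    squareEquation : Triple → List (Polynomial 4)
    squareEquation ⟨ p , q , r ⟩ =
      c₀ difference ∷ c₁ difference ∷ c₂ difference ∷ []
      where
      open Generic using (c₀; c₁; c₂)
      difference = generic Generic.⊗ generic Generic.⊕
        con -[1+ 0 ] Generic.• Generic.⟨ con p , con q , con r ⟩

    -- One search over the residues modulo 4 of `a` and of the three coordinates of `s` covers every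
    -- order of the family at once, because `a` is itself a variable of the polynomials.
    nonSquareMod4 : ∀ t {_ : True (noCommonZero? 4 (squareEquation t))} →
                    ∀ s → ¬ (+ 4 ∣³ (s ⊗ s ⊖ t))
    nonSquareMod4 t {check} s (d₀ , d₁ , d₂) =
      noCommonZero 4 (squareEquation t) {check} (environment s) (d₀ ∷ d₁ ∷ d₂ ∷ [])

open CubicOrders

-- The homomorphism from ℤ to a commutative ring

module IntegersIn {c ℓ} (R : CommutativeRing c ℓ) where

  open CommutativeRing R
  open RingProperties ring
  open Mult′ semiring using (1+×; ×ᵤ≈×; ×-homo-+; ×1-homo-*) renaming (_×_ to _·_)
  open import Relation.Binary.Reasoning.Setoid setoid

  -- Built on the optimised multiples, for which `ι (+ 1)` reduces to `1#` rather than to `1# + 0#`;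
  -- the field `1-homo` below relies on this.
  ι : ℤ → Carrier
  ι (+ n)    = n · 1#
  ι -[1+ n ] = - (suc n · 1#)

  x≈[y+x]-y : ∀ x y → x ≈ (y + x) - y
  x≈[y+x]-y x y = begin
    x             ≈⟨ +-identityʳ x ⟨
    x + 0#        ≈⟨ +-congˡ (-‿inverseʳ y) ⟨
    x + (y - y)   ≈⟨ +-assoc x y (- y) ⟨
    (x + y) - y   ≈⟨ +-congʳ (+-comm x y) ⟩
    (y + x) - y   ∎

  ι-⊖ : ∀ m n → ι (m ℤ.⊖ n) ≈ m · 1# - n · 1#
  ι-⊖ m       zero    = sym (trans (+-congˡ -0#≈0#) (+-identityʳ _))
  ι-⊖ zero    (suc n) = sym (+-identityˡ _)
  ι-⊖ (suc m) (suc n) = begin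
    ι (suc m ℤ.⊖ suc n)                   ≡⟨ ≡.cong ι (ℤ.[1+m]⊖[1+n]≡m⊖n m n) ⟩
    ι (m ℤ.⊖ n)                           ≈⟨ ι-⊖ m n ⟩
    m · 1# - n · 1#                       ≈⟨ +-congʳ (x≈[y+x]-y _ 1#) ⟩
    ((1# + m · 1#) - 1#) - n · 1#         ≈⟨ +-assoc _ _ _ ⟩
    (1# + m · 1#) + (- 1# - n · 1#)       ≈⟨ +-congˡ (-‿+-comm 1# (n · 1#)) ⟩
    (1# + m · 1#) - (1# + n · 1#)         ≈⟨ +-cong (1+× m 1#) (-‿cong (1+× n 1#)) ⟨
    suc m · 1# - suc n · 1#               ∎

  ι-+ : ∀ i j → ι (i ℤ.+ j) ≈ ι i + ι j
  ι-+ (+ m)    (+ n)    = ×-homo-+ 1# m n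
  ι-+ (+ m)    -[1+ n ] = ι-⊖ m (suc n)
  ι-+ -[1+ m ] (+ n)    = trans (ι-⊖ n (suc m)) (+-comm _ _)
  ι-+ -[1+ m ] -[1+ n ] = begin
    - (suc (suc (m ℕ.+ n)) · 1#)          ≈⟨ -‿cong (1+× (suc (m ℕ.+ n)) 1#) ⟩
    - (1# + (suc m ℕ.+ n) · 1#)           ≈⟨ -‿cong (+-congˡ (×-homo-+ 1# (suc m) n)) ⟩
    - (1# + (suc m · 1# + n · 1#))        ≈⟨ -‿cong (+-congˡ (+-comm _ _)) ⟩
    - (1# + (n · 1# + suc m · 1#))        ≈⟨ -‿cong (+-assoc _ _ _) ⟨
    - ((1# + n · 1#) + suc m · 1#)        ≈⟨ -‿cong (+-congʳ (1+× n 1#)) ⟨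
    - (suc n · 1# + suc m · 1#)           ≈⟨ -‿cong (+-comm _ _) ⟩
    - (suc m · 1# + suc n · 1#)           ≈⟨ -‿+-comm _ _ ⟨
    - (suc m · 1#) - suc n · 1#           ∎

  ι-neg : ∀ i → ι (ℤ.- i) ≈ - ι i
  ι-neg (+ zero)  = sym -0#≈0#
  ι-neg (+ suc n) = refl
  ι-neg -[1+ n ]  = sym (-‿involutive _)

  ι-*ⁿ : ∀ m j → ι (+ m ℤ.* j) ≈ ι (+ m) * ι j
  ι-*ⁿ m (+ n) = begin
    ι (+ m ℤ.* + n)  ≡⟨ ≡.cong ι (ℤ.pos-* m n) ⟨
    (m ℕ.* n) · 1#   ≈⟨ ×1-homo-* m n ⟩
    m · 1# * n · 1#  ∎
  ι-*ⁿ m -[1+ n ] = begin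
    ι (+ m ℤ.* -[1+ n ])         ≡⟨ ≡.cong ι (ℤ.neg-distribʳ-* (+ m) (+ suc n)) ⟨
    ι (ℤ.- (+ m ℤ.* + suc n))    ≈⟨ ι-neg (+ m ℤ.* + suc n) ⟩
    - ι (+ m ℤ.* + suc n)        ≈⟨ -‿cong (ι-*ⁿ m (+ suc n)) ⟩
    - (m · 1# * suc n · 1#)      ≈⟨ -‿distribʳ-* _ _ ⟩
    m · 1# * - (suc n · 1#)      ∎

  ι-* : ∀ i j → ι (i ℤ.* j) ≈ ι i * ι j
  ι-* (+ m)    j = ι-*ⁿ m j
  ι-* -[1+ m ] j = begin
    ι (-[1+ m ] ℤ.* j)           ≡⟨ ≡.cong ι (ℤ.neg-distribˡ-* (+ suc m) j) ⟨
    ι (ℤ.- (+ suc m ℤ.* j))      ≈⟨ ι-neg (+ suc m ℤ.* j) ⟩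
    - ι (+ suc m ℤ.* j)          ≈⟨ -‿cong (ι-*ⁿ (suc m) j) ⟩
    - (suc m · 1# * ι j)         ≈⟨ -‿distribˡ-* _ _ ⟩
    - (suc m · 1#) * ι j         ∎

  ι-homomorphism : CommutativeRing.rawRing ℤ.+-*-commutativeRing -Raw-AlmostCommutative⟶ fromCommutativeRing R
  ι-homomorphism = record
    { ⟦_⟧ = ι ; +-homo = ι-+ ; *-homo = ι-* ; -‿homo = ι-neg ; 0-homo = refl ; 1-homo = refl }

  -- Coefficients are taken in ℤ, where equality is decidable. Numerals such as 3 and -1 can thus be
  -- normalised although equality in `R` need not be decidable.
  open RingSolver _ (fromCommutativeRing R) ι-homomorphism
    (λ i j → Maybe.map (λ eq → reflexive (≡.cong ι eq)) (dec⇒maybe (i ℤ.≟ j))) public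
    using (solve; con; _:+_; _:*_; _:-_; :-_; _:=_)

-- Heyting fields of characteristic zero

module Field {c ℓ₁ ℓ₂} (F : HeytingField c ℓ₁ ℓ₂) (characteristicZero : CharacteristicZero F) where

  open HeytingField F using (tight; #⇒invertible)
  commutativeRing = HeytingCommutativeRing.commutativeRing (HeytingField.heytingCommutativeRing F)
  open CommutativeRing commutativeRing public
  open RingProperties ring public
  open IntegersIn commutativeRing public
  open Mult semiring using (×-assoc-*) renaming (_×_ to _·_)
  open Mult′ semiring using (×ᵤ≈×)
  open import Relation.Binary.Reasoning.Setoid setoid public

  ·≈ι* : ∀ n x → n · x ≈ ι (+ n) * x
  ·≈ι* n x = begin
    n · x           ≈⟨ Mult.×-congʳ semiring n (*-identityˡ x) ⟨
    n · (1# * x)    ≈⟨ ×-assoc-* n 1# x ⟨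
    (n · 1#) * x    ≈⟨ *-congʳ (×ᵤ≈× n 1#) ⟩
    ι (+ n) * x     ∎

  ℤ·≈ι* : ∀ n x → _ℤ·_ F n x ≈ ι n * x
  ℤ·≈ι* (+ n)    x = ·≈ι* n x
  ℤ·≈ι* -[1+ n ] x = trans (-‿cong (·≈ι* (suc n) x)) (-‿distribˡ-* _ x)

  ι≈0⇒≡0 : ∀ n → ι n ≈ 0# → n ≡ + 0
  ι≈0⇒≡0 (+ zero)  _  = ≡.refl
  ι≈0⇒≡0 (+ suc n) eq =
    contradiction (trans (×ᵤ≈× (suc n) 1#) eq) (characteristicZero (suc n))
  ι≈0⇒≡0 -[1+ n ]  eq =
    contradiction (trans (×ᵤ≈× (suc n) 1#) (trans (sym (-‿involutive _)) (trans (-‿cong eq) -0#≈0#)))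
                  (characteristicZero (suc n))

  -- By tightness it is enough to refute `y # 0#`. An element apart from 0 is invertible, and
  -- multiplying `x * y ≈ 0#` by the inverse of `y` would give `x ≈ 0#`. Only the negation of
  -- `x ≈ 0#` is used, not apartness.
  x*y≈0⇒y≈0 : ∀ {x y} → ¬ (x ≈ 0#) → x * y ≈ 0# → y ≈ 0#
  x*y≈0⇒y≈0 {x} {y} x≉0 xy≈0 = proj₁ (tight _ _) λ y#0 →
    let (y⁻¹ , _ , y*y⁻¹≈1) = #⇒invertible y#0 in
    x≉0 (begin
      x                      ≈⟨ *-identityʳ x ⟨
      x * 1#                 ≈⟨ *-congˡ y*y⁻¹≈1 ⟨
      x * ((y - 0#) * y⁻¹)   ≈⟨ solve 3 (λ x y z → x :* ((y :- con (+ 0)) :* z) := (x :* y) :* z) refl x y y⁻¹ ⟩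
      (x * y) * y⁻¹          ≈⟨ *-congʳ xy≈0 ⟩
      0# * y⁻¹               ≈⟨ zeroˡ y⁻¹ ⟩
      0#                     ∎)

  x-y≈0⇒x≈y : ∀ {x y} → x - y ≈ 0# → x ≈ y
  x-y≈0⇒x≈y {x} {y} eq = begin
    x            ≈⟨ solve 2 (λ x y → x := (x :- y) :+ y) refl x y ⟩
    (x - y) + y  ≈⟨ +-congʳ eq ⟩
    0# + y       ≈⟨ +-identityˡ y ⟩
    y            ∎

-- Evaluation of coordinates at the root α

module Root {c ℓ₁ ℓ₂} (F : HeytingField c ℓ₁ ℓ₂) (char0 : CharacteristicZero F)
            (a : ℤ) (α : HeytingField.Carrier F) (isRoot : IsRoot F a α) where

  open Field F char0
  open CubicOrder a

  b d : ℤ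
  b = a ℤ.- + 1
  d = a ℤ.+ + 2

  α³≈ : α * (α * α) ≈ 1# + ι d * α + ι b * (α * α)
  α³≈ = x-y≈0⇒x≈y (begin
    α * (α * α) - (1# + ι d * α + ι b * (α * α))
      ≈⟨ solve 3 (λ α b d → let 1′ = con (+ 1) in
           α :* (α :* α) :- (1′ :+ d :* α :+ b :* (α :* α)) :=
           α :* (α :* (α :* 1′)) :- b :* (α :* (α :* 1′)) :- d :* (α :* 1′) :- 1′) refl α (ι b) (ι d) ⟩
    α * (α * (α * 1#)) - ι b * (α * (α * 1#)) - ι d * (α * 1#) - 1#
      ≈⟨ +-congʳ (+-cong (+-congˡ (-‿cong (ℤ·≈ι* b _))) (-‿cong (ℤ·≈ι* d (α * 1#)))) ⟨
    _ ≈⟨ +-congʳ (+-congˡ (-‿cong (ℤ·-congʳ d (*-identityʳ α)))) ⟩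
    _ ≈⟨ isRoot ⟩
    0# ∎)
    where
    ℤ·-congʳ : ∀ n {x y} → x ≈ y → _ℤ·_ F n x ≈ _ℤ·_ F n y
    ℤ·-congʳ n {x} {y} eq = trans (ℤ·≈ι* n x) (trans (*-congˡ eq) (sym (ℤ·≈ι* n y)))

  ev : Triple → Carrier
  ev ⟨ p , q , r ⟩ = ι p + ι q * α + ι r * (α * α)

  ev-⊕ : ∀ s t → ev (s ⊕ t) ≈ ev s + ev t
  ev-⊕ ⟨ p , q , r ⟩ ⟨ p′ , q′ , r′ ⟩ = begin
    ι (p ℤ.+ p′) + ι (q ℤ.+ q′) * α + ι (r ℤ.+ r′) * (α * α)
      ≈⟨ +-cong (+-cong (ι-+ p p′) (*-congʳ (ι-+ q q′))) (*-congʳ (ι-+ r r′)) ⟩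
    (ι p + ι p′) + (ι q + ι q′) * α + (ι r + ι r′) * (α * α)
      ≈⟨ solve 7 (λ p q r p′ q′ r′ α →
           (p :+ p′) :+ (q :+ q′) :* α :+ (r :+ r′) :* (α :* α) :=
           (p :+ q :* α :+ r :* (α :* α)) :+ (p′ :+ q′ :* α :+ r′ :* (α :* α))) refl
           (ι p) (ι q) (ι r) (ι p′) (ι q′) (ι r′) α ⟩
    _ ∎

  ev-• : ∀ n s → ev (n • s) ≈ ι n * ev s
  ev-• n ⟨ p , q , r ⟩ = begin
    ι (n ℤ.* p) + ι (n ℤ.* q) * α + ι (n ℤ.* r) * (α * α)
      ≈⟨ +-cong (+-cong (ι-* n p) (*-congʳ (ι-* n q))) (*-congʳ (ι-* n r)) ⟩
    (ι n * ι p) + (ι n * ι q) * α + (ι n * ι r) * (α * α)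
      ≈⟨ solve 5 (λ n p q r α →
           (n :* p) :+ (n :* q) :* α :+ (n :* r) :* (α :* α) :=
           n :* (p :+ q :* α :+ r :* (α :* α))) refl
           (ι n) (ι p) (ι q) (ι r) α ⟩
    _ ∎

  ev-α• : ∀ s → ev (α• s) ≈ α * ev s
  ev-α• ⟨ p , q , r ⟩ = begin
    ι r + ι (p ℤ.+ d ℤ.* r) * α + ι (q ℤ.+ b ℤ.* r) * (α * α)
      ≈⟨ +-cong (+-congˡ (*-congʳ (homo p d r))) (*-congʳ (homo q b r)) ⟩
    ι r + (ι p + ι d * ι r) * α + (ι q + ι b * ι r) * (α * α)
      ≈⟨ solve 6 (λ p q r α b d →
           r :+ (p :+ d :* r) :* α :+ (q :+ b :* r) :* (α :* α) :=
           p :* α :+ q :* (α :* α) :+ r :* (con (+ 1) :+ d :* α :+ b :* (α :* α))) refl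
           (ι p) (ι q) (ι r) α (ι b) (ι d) ⟩
    ι p * α + ι q * (α * α) + ι r * (1# + ι d * α + ι b * (α * α))
      ≈⟨ +-congˡ (*-congˡ α³≈) ⟨
    ι p * α + ι q * (α * α) + ι r * (α * (α * α))
      ≈⟨ solve 4 (λ p q r α →
           p :* α :+ q :* (α :* α) :+ r :* (α :* (α :* α)) :=
           α :* (p :+ q :* α :+ r :* (α :* α))) refl (ι p) (ι q) (ι r) α ⟩
    _ ∎
    where
    homo : ∀ x y z → ι (x ℤ.+ y ℤ.* z) ≈ ι x + ι y * ι z
    homo x y z = trans (ι-+ x (y ℤ.* z)) (+-congˡ (ι-* y z))

  ev-⊗ : ∀ s t → ev (s ⊗ t) ≈ ev s * ev t
  ev-⊗ ⟨ p , q , r ⟩ t = begin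
    ev (p • t ⊕ q • α• t ⊕ r • α• α• t)
      ≈⟨ trans (ev-⊕ (p • t ⊕ q • α• t) (r • α• α• t)) (+-congʳ (ev-⊕ (p • t) (q • α• t))) ⟩
    ev (p • t) + ev (q • α• t) + ev (r • α• α• t)
      ≈⟨ +-cong (+-cong (ev-• p t) (ev-• q (α• t))) (ev-• r (α• α• t)) ⟩
    ι p * ev t + ι q * ev (α• t) + ι r * ev (α• α• t)
      ≈⟨ +-cong (+-congˡ (*-congˡ (ev-α• t))) (*-congˡ (trans (ev-α• (α• t)) (*-congˡ (ev-α• t)))) ⟩
    ι p * ev t + ι q * (α * ev t) + ι r * (α * (α * ev t))
      ≈⟨ solve 5 (λ p q r α t →
           p :* t :+ q :* (α :* t) :+ r :* (α :* (α :* t)) :=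
           (p :+ q :* α :+ r :* (α :* α)) :* t) refl (ι p) (ι q) (ι r) α (ev t) ⟩
    _ ∎

  ev-constant : ∀ n → ev ⟨ n , + 0 , + 0 ⟩ ≈ ι n
  ev-constant n = solve 2 (λ n α → n :+ con (+ 0) :* α :+ con (+ 0) :* (α :* α) := n) refl (ι n) α

  ev-generator : ev α̂ ≈ α
  ev-generator = solve 1 (λ α → con (+ 0) :+ con (+ 1) :* α :+ con (+ 0) :* (α :* α) := α) refl α

  coordinates : ∀ {x} → x ∈ ℤ[_] F α → ∃ λ s → x ≈ ev s
  coordinates generator = α̂ , sym ev-generator
  coordinates 1#-mem = 1̂ , sym (ev-constant (+ 1))
  coordinates (+-closed x∈ y∈) =
    let (s , x≈) = coordinates x∈ ; (t , y≈) = coordinates y∈ in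
    s ⊕ t , trans (+-cong x≈ y≈) (sym (ev-⊕ s t))
  coordinates (*-closed x∈ y∈) =
    let (s , x≈) = coordinates x∈ ; (t , y≈) = coordinates y∈ in
    s ⊗ t , trans (*-cong x≈ y≈) (sym (ev-⊗ s t))
  coordinates (-‿closed x∈) =
    let (s , x≈) = coordinates x∈ in
    -[1+ 0 ] • s , trans (-‿cong x≈) (sym (trans (ev-• -[1+ 0 ] s) (-1*x≈-x (ev s))))
  coordinates (resp-≈ y≈x y∈) =
    let (s , y≈) = coordinates y∈ in s , trans (sym y≈x) y≈

  -- The product of `adjugate s` and `s` evaluates to the integer `norm s`, which vanishes in the
  -- field together with `ev s`, and characteristic zero makes it the integer 0.
  ev≈0⇒norm≡0 : ∀ s → ev s ≈ 0# → norm s ≡ + 0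
  ev≈0⇒norm≡0 s ev≈0 = ι≈0⇒≡0 (norm s) (begin
    ι (norm s)                   ≈⟨ ev-constant (norm s) ⟨
    ev ⟨ norm s , + 0 , + 0 ⟩    ≡⟨ ≡.cong ev (adjugate-⊗ s) ⟨
    ev (adjugate s ⊗ s)          ≈⟨ ev-⊗ (adjugate s) s ⟩
    ev (adjugate s) * ev s       ≈⟨ *-congˡ ev≈0 ⟩
    ev (adjugate s) * 0#         ≈⟨ zeroʳ _ ⟩
    0#                           ∎)

  -- A vanishing norm is in particular even, so all three coordinates are even, and 2 can be
  -- cancelled in characteristic zero.
  ev≈0⇒half : ∀ s → ev s ≈ 0# → ∃ λ t → s ≡ + 2 • t × ev t ≈ 0#
  ev≈0⇒half s ev≈0 =
    let (t , s≡2t) = ∣³⇒• (2∣norm⇒2∣³ s (divides (+ 0) (ev≈0⇒norm≡0 s ev≈0))) in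
    t , s≡2t ,
    x*y≈0⇒y≈0 (λ 2≈0 → contradiction (ι≈0⇒≡0 (+ 2) 2≈0) λ ())
      (trans (sym (ev-• (+ 2) t)) (trans (reflexive (≡.cong ev (≡.sym s≡2t))) ev≈0))

  -- A descent cut short: halving could be repeated forever, but two rounds already bring equalities
  -- in the field down to congruences modulo 4.
  ev≈0⇒4∣³ : ∀ s → ev s ≈ 0# → + 4 ∣³ s
  ev≈0⇒4∣³ s ev≈0 =
    let (t , s≡2t , evt≈0) = ev≈0⇒half s ev≈0
        (u , t≡2u , _)     = ev≈0⇒half t evt≈0
    in ≡.subst (+ 4 ∣³_) (≡.sym (≡.trans s≡2t (≡.cong (+ 2 •_) t≡2u))) (4∣³2•2• u)

  -- If `w` has coordinates `s`, then `s ⊗ s ⊖ t` evaluates to 0, so its coordinates are divisible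
  -- by 4, against the finite check.
  nonSquare : ∀ t {_ : True (noCommonZero? 4 (squareEquation t))} →
              ∀ {w} → w ∈ ℤ[_] F α → ¬ (w * w ≈ ev t)
  nonSquare t {check} {w} w∈ w²≈t =
    let (s , w≈s) = coordinates w∈ in
    nonSquareMod4 t {check} s (ev≈0⇒4∣³ (s ⊗ s ⊖ t) (begin
      ev (s ⊗ s ⊖ t)                  ≈⟨ ev-⊕ (s ⊗ s) (-[1+ 0 ] • t) ⟩
      ev (s ⊗ s) + ev (-[1+ 0 ] • t)  ≈⟨ +-cong (ev-⊗ s s) (ev-• -[1+ 0 ] t) ⟩
      ev s * ev s + - 1# * ev t       ≈⟨ +-cong (*-cong w≈s w≈s) (*-congˡ w²≈t) ⟨
      w * w + - 1# * (w * w)          ≈⟨ +-congˡ (-1*x≈-x _) ⟩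
      w * w - w * w                   ≈⟨ -‿inverseʳ _ ⟩
      0#                              ∎))

-- Integer powers of a unit

module IntegerPowers {c ℓ} (R : CommutativeRing c ℓ) where

  open CommutativeRing R
  open IntegersIn R using (solve; _:*_; _:=_; con)
  open RawSemiringDefinitions (Semiring.rawSemiring semiring) public using (_^_)
  open import Relation.Binary.Reasoning.Setoid setoid

  module _ {u v : Carrier} (uv≈1 : u * v ≈ 1#) where

    power : ℤ → Carrier
    power (+ n)    = u ^ n
    power -[1+ n ] = v ^ suc n

    cancel-uv : ∀ x → u * (v * x) ≈ x
    cancel-uv x = trans (sym (*-assoc u v x)) (trans (*-congʳ uv≈1) (*-identityˡ x))

    power-suc : ∀ i → power (ℤ.suc i) ≈ u * power i
    power-suc (+ n)          = refl
    power-suc -[1+ zero ]    = sym (cancel-uv 1#)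
    power-suc -[1+ suc n ]   = sym (cancel-uv (v ^ suc n))

    power-+ⁿ : ∀ m j → power (+ m ℤ.+ j) ≈ u ^ m * power j
    power-+ⁿ zero    j = trans (reflexive (≡.cong power (ℤ.+-identityˡ j))) (sym (*-identityˡ _))
    power-+ⁿ (suc m) j = begin
      power (+ suc m ℤ.+ j)        ≡⟨ ≡.cong power (ℤ.+-assoc (+ 1) (+ m) j) ⟩
      power (ℤ.suc (+ m ℤ.+ j))    ≈⟨ power-suc (+ m ℤ.+ j) ⟩
      u * power (+ m ℤ.+ j)        ≈⟨ *-congˡ (power-+ⁿ m j) ⟩
      u * (u ^ m * power j)        ≈⟨ *-assoc u _ _ ⟨
      u ^ suc m * power j          ∎

    cancel-vuⁿ : ∀ n x → v ^ n * (u ^ n * x) ≈ x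
    cancel-vuⁿ zero    x = trans (*-identityˡ _) (*-identityˡ x)
    cancel-vuⁿ (suc n) x = begin
      (v * v ^ n) * ((u * u ^ n) * x)
        ≈⟨ solve 5 (λ u v y z x → (v :* y) :* ((u :* z) :* x) := y :* (z :* (u :* (v :* x)))) refl
             u v (v ^ n) (u ^ n) x ⟩
      v ^ n * (u ^ n * (u * (v * x)))   ≈⟨ cancel-vuⁿ n _ ⟩
      u * (v * x)                       ≈⟨ cancel-uv x ⟩
      x                                 ∎

    power-+ : ∀ i j → power (i ℤ.+ j) ≈ power i * power j
    power-+ (+ m)    j = power-+ⁿ m j
    power-+ -[1+ m ] j = begin
      -- Multiplying by `u ^ suc m` brings the exponent `k` back to `j`, so only the rule for
      -- natural exponents is needed.
      power k                                    ≈⟨ cancel-vuⁿ (suc m) (power k) ⟨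
      v ^ suc m * (u ^ suc m * power k)          ≈⟨ *-congˡ (power-+ⁿ (suc m) k) ⟨
      v ^ suc m * power (+ suc m ℤ.+ k)          ≡⟨ ≡.cong (λ i → v ^ suc m * power i) m+k≡j ⟩
      v ^ suc m * power j                        ∎
      where
      k = -[1+ m ] ℤ.+ j
      m+k≡j : + suc m ℤ.+ k ≡ j
      m+k≡j = ≡.trans (≡.sym (ℤ.+-assoc (+ suc m) -[1+ m ] j))
        (≡.trans (≡.cong (ℤ._+ j) (ℤ.+-inverseʳ (+ suc m))) (ℤ.+-identityˡ j))

-- Multiplicative independence of α and γ modulo ±1

module IndependentUnits {c ℓ₁ ℓ₂} (F : HeytingField c ℓ₁ ℓ₂) (char0 : CharacteristicZero F)
            (a : ℤ) (α : HeytingField.Carrier F) (isRoot : IsRoot F a α) where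

  open Field F char0 public
  open CubicOrder a public
  open Root F char0 a α isRoot public
  open IntegerPowers commutativeRing public

  ι∈ : ∀ n → ι n ∈ ℤ[_] F α
  ι∈ = λ where
      (+ n)    → natural n
      -[1+ n ] → -‿closed (natural (suc n))
    where
    natural : ∀ n → ι (+ n) ∈ ℤ[_] F α
    natural 0             = resp-≈ (-‿inverseʳ 1#) (+-closed 1#-mem (-‿closed 1#-mem))
    natural 1             = 1#-mem
    natural (suc (suc n)) = +-closed (natural (suc n)) 1#-mem

  ev∈ : ∀ s → ev s ∈ ℤ[_] F α
  ev∈ ⟨ p , q , r ⟩ = +-closed (+-closed (ι∈ p) (*-closed (ι∈ q) generator))
                               (*-closed (ι∈ r) (*-closed generator generator))

  γ α⁻¹ γ⁻¹ : Carrier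
  γ = ev γ̂
  α⁻¹ = ev α̂⁻¹
  γ⁻¹ = ev γ̂⁻¹

  γ≈-1-α : γ ≈ - 1# - α
  γ≈-1-α = solve 1 (λ α → con -[1+ 0 ] :+ con -[1+ 0 ] :* α :+ con (+ 0) :* (α :* α)
                            := :- con (+ 1) :- α) refl α

  αα⁻¹≈1 : α * α⁻¹ ≈ 1#
  αα⁻¹≈1 = begin
    α * α⁻¹       ≈⟨ ev-α• α̂⁻¹ ⟨
    ev (α• α̂⁻¹)   ≡⟨ ≡.cong₂ (λ q r → ev ⟨ + 1 , q , r ⟩) (cancel d) (cancel b) ⟩
    ev 1̂          ≈⟨ ev-constant (+ 1) ⟩
    1#            ∎
    where
    cancel : ∀ n → ℤ.- n ℤ.+ n ℤ.* + 1 ≡ + 0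
    cancel n = ≡.trans (≡.cong (ℤ._+_ (ℤ.- n)) (ℤ.*-identityʳ n)) (ℤ.+-inverseˡ n)

  γγ⁻¹≈1 : γ * γ⁻¹ ≈ 1#
  γγ⁻¹≈1 = begin
    γ * γ⁻¹        ≈⟨ ev-⊗ γ̂ γ̂⁻¹ ⟨
    ev (γ̂ ⊗ γ̂⁻¹)   ≡⟨ ≡.cong ev γ⊗γ⁻¹≡1 ⟩
    ev 1̂           ≈⟨ ev-constant (+ 1) ⟩
    1#             ∎

  power∈ : ∀ {u v} (uv≈1 : u * v ≈ 1#) → u ∈ ℤ[_] F α → v ∈ ℤ[_] F α → ∀ i → power uv≈1 i ∈ ℤ[_] F α
  power∈ uv≈1 u∈ v∈ = λ where
      (+ n)    → natural u∈ n
      -[1+ n ] → natural v∈ (suc n)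
    where
    natural : ∀ {w} → w ∈ ℤ[_] F α → ∀ n → w ^ n ∈ ℤ[_] F α
    natural w∈ zero    = 1#-mem
    natural w∈ (suc n) = *-closed w∈ (natural w∈ n)

  unit : ℤ → ℤ → Carrier
  unit i j = power αα⁻¹≈1 i * power γγ⁻¹≈1 j

  unit∈ : ∀ i j → unit i j ∈ ℤ[_] F α
  unit∈ i j = *-closed (power∈ αα⁻¹≈1 generator (ev∈ α̂⁻¹) i) (power∈ γγ⁻¹≈1 (ev∈ γ̂) (ev∈ γ̂⁻¹) j)

  unit-+ : ∀ i j i′ j′ → unit (i ℤ.+ i′) (j ℤ.+ j′) ≈ unit i j * unit i′ j′
  unit-+ i j i′ j′ = begin
    power αα⁻¹≈1 (i ℤ.+ i′) * power γγ⁻¹≈1 (j ℤ.+ j′)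
      ≈⟨ *-cong (power-+ αα⁻¹≈1 i i′) (power-+ γγ⁻¹≈1 j j′) ⟩
    (power αα⁻¹≈1 i * power αα⁻¹≈1 i′) * (power γγ⁻¹≈1 j * power γγ⁻¹≈1 j′)
      ≈⟨ solve 4 (λ x y z w → (x :* y) :* (z :* w) := (x :* z) :* (y :* w)) refl
           (power αα⁻¹≈1 i) (power αα⁻¹≈1 i′) (power γγ⁻¹≈1 j) (power γγ⁻¹≈1 j′) ⟩
    unit i j * unit i′ j′ ∎

  unit-inverse : ∀ i j → unit i j * unit (ℤ.- i) (ℤ.- j) ≈ 1#
  unit-inverse i j = begin
    unit i j * unit (ℤ.- i) (ℤ.- j)      ≈⟨ unit-+ i j (ℤ.- i) (ℤ.- j) ⟨
    unit (i ℤ.- i) (j ℤ.- j)             ≡⟨ ≡.cong₂ unit (ℤ.+-inverseʳ i) (ℤ.+-inverseʳ j) ⟩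
    1# * 1#                              ≈⟨ *-identityˡ 1# ⟩
    1#                                   ∎

  ± : Sign → Carrier
  ± σ = ι (σ ◃ 1)

  ±-* : ∀ σ τ → ± (σ Sign.* τ) ≈ ± σ * ± τ
  ±-* Sign.+ Sign.+ = ι-* (+ 1) (+ 1)
  ±-* Sign.+ Sign.- = ι-* (+ 1) -[1+ 0 ]
  ±-* Sign.- Sign.+ = ι-* -[1+ 0 ] (+ 1)
  ±-* Sign.- Sign.- = ι-* -[1+ 0 ] -[1+ 0 ]

  ±²≈1 : ∀ σ → ± σ * ± σ ≈ 1#
  ±²≈1 Sign.+ = sym (±-* Sign.+ Sign.+)
  ±²≈1 Sign.- = sym (±-* Sign.- Sign.-)

  -- If e w² = ± 1 then w⁻² = ± e.
  nonSquareTimes : ∀ s σ {_ : True (noCommonZero? 4 (squareEquation ((σ ◃ 1) • s)))} →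
                   ∀ i j → ¬ (ev s * (unit i j * unit i j) ≈ ± σ)
  nonSquareTimes s σ {check} i j ew²≈± =
    nonSquare ((σ ◃ 1) • s) {check} (unit∈ (ℤ.- i) (ℤ.- j)) (begin
      v * v                            ≈⟨ *-identityˡ _ ⟨
      1# * (v * v)                     ≈⟨ *-congʳ (±²≈1 σ) ⟨
      (± σ * ± σ) * (v * v)            ≈⟨ *-congʳ (*-congˡ ew²≈±) ⟨
      (± σ * (ev s * (w * w))) * (v * v)
        ≈⟨ solve 4 (λ σ e w v → (σ :* (e :* (w :* w))) :* (v :* v) :=
                                 (σ :* e) :* ((w :* v) :* (w :* v))) refl (± σ) (ev s) w v ⟩
      (± σ * ev s) * ((w * v) * (w * v))
        ≈⟨ *-congˡ (*-cong (unit-inverse i j) (unit-inverse i j)) ⟩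
      (± σ * ev s) * (1# * 1#)         ≈⟨ trans (*-congˡ (*-identityˡ 1#)) (*-identityʳ _) ⟩
      ± σ * ev s                       ≈⟨ ev-• (σ ◃ 1) s ⟨
      ev ((σ ◃ 1) • s)                 ∎)
    where
    w = unit i j
    v = unit (ℤ.- i) (ℤ.- j)

  unit-even : ∀ i j i₀ j₀ {e} → unit i₀ j₀ ≈ e →
              unit (i₀ ℤ.+ i ℤ.* + 2) (j₀ ℤ.+ j ℤ.* + 2) ≈ e * (unit i j * unit i j)
  unit-even i j i₀ j₀ {e} eq = begin
    unit (i₀ ℤ.+ i ℤ.* + 2) (j₀ ℤ.+ j ℤ.* + 2)  ≈⟨ unit-+ i₀ j₀ (i ℤ.* + 2) (j ℤ.* + 2) ⟩
    unit i₀ j₀ * unit (i ℤ.* + 2) (j ℤ.* + 2)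
      ≡⟨ ≡.cong (unit i₀ j₀ *_) (≡.cong₂ unit (n*2≡n+n i) (n*2≡n+n j)) ⟩
    unit i₀ j₀ * unit (i ℤ.+ i) (j ℤ.+ j)        ≈⟨ *-cong eq (unit-+ i j i j) ⟩
    e * (unit i j * unit i j)                    ∎

  unit-10 : unit (+ 1) (+ 0) ≈ ev α̂
  unit-10 = trans (*-identityʳ _) (trans (*-identityʳ α) (sym ev-generator))

  unit-01 : unit (+ 0) (+ 1) ≈ γ
  unit-01 = trans (*-identityˡ _) (*-identityʳ γ)

  unit-11 : unit (+ 1) (+ 1) ≈ ev αγ̂
  unit-11 = trans (*-cong (*-identityʳ α) (*-identityʳ γ)) (solve 1 (λ α →
    α :* (con -[1+ 0 ] :+ con -[1+ 0 ] :* α :+ con (+ 0) :* (α :* α)) :=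
    con (+ 0) :+ con -[1+ 0 ] :* α :+ con -[1+ 0 ] :* (α :* α)) refl α)

  Trivial : ℤ → ℤ → Set
  Trivial i j = i ≡ + 0 × j ≡ + 0

  -- Excludes relations with an odd exponent. In its uses `ev s` is α, γ or αγ, and the two checks
  -- say that neither it nor its negative is a square modulo 4.
  evenTimes≉± : ∀ i₀ j₀ s → unit i₀ j₀ ≈ ev s →
    {_ : True (noCommonZero? 4 (squareEquation ((Sign.+ ◃ 1) • s)))}
    {_ : True (noCommonZero? 4 (squareEquation ((Sign.- ◃ 1) • s)))} →
    ∀ k l σ → ¬ (unit (i₀ ℤ.+ k ℤ.* + 2) (j₀ ℤ.+ l ℤ.* + 2) ≈ ± σ)
  evenTimes≉± i₀ j₀ s eq {check₊} {check₋} k l Sign.+ u≈± =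
    nonSquareTimes s Sign.+ {check₊} k l (trans (sym (unit-even k l i₀ j₀ eq)) u≈±)
  evenTimes≉± i₀ j₀ s eq {check₊} {check₋} k l Sign.- u≈± =
    nonSquareTimes s Sign.- {check₋} k l (trans (sym (unit-even k l i₀ j₀ eq)) u≈±)

  -- For w = `unit k l`, the equation w² = -1 would make -1 the square of w⁻¹, while w² = 1 factors
  -- as (w - 1)(w + 1) = 0 and leads back to a relation w = ±1.
  square-trivial : ∀ k l → (∀ σ → unit k l ≈ ± σ → Trivial k l) →
    ∀ σ → unit (+ 0 ℤ.+ k ℤ.* + 2) (+ 0 ℤ.+ l ℤ.* + 2) ≈ ± σ → Trivial k l
  square-trivial k l trivial Sign.- u≈- = contradiction
    (trans (sym (unit-even k l (+ 0) (+ 0) (trans (*-identityˡ 1#) (sym (ev-constant (+ 1)))))) u≈-)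
    (nonSquareTimes 1̂ Sign.- k l)
  square-trivial k l trivial Sign.+ u≈+ =
    -- It need not be decidable which factor vanishes. Triviality of the exponents is decidable, so
    -- a proof by contradiction is available: if they are not trivial, then w is not 1, so w is -1,
    -- and the exponents are trivial after all.
    decidable-stable ((k ℤ.≟ + 0) ×-dec (l ℤ.≟ + 0)) λ nontrivial →
      nontrivial (trivial Sign.- (w≈-1 λ w≈1 → nontrivial (trivial Sign.+ w≈1)))
    where
    w = unit k l
    w≈-1 : ¬ (w ≈ 1#) → w ≈ - 1#
    w≈-1 w≉1 = x-y≈0⇒x≈y (x*y≈0⇒y≈0 (λ w-1≈0 → w≉1 (x-y≈0⇒x≈y w-1≈0)) (begin
      (w - 1#) * (w - - 1#)
        ≈⟨ solve 1 (λ w → let 1′ = con (+ 1) in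
             (w :- 1′) :* (w :- (:- 1′)) := 1′ :* (w :* w) :- 1′) refl w ⟩
      1# * (w * w) - 1#         ≈⟨ +-congʳ (trans (sym (unit-even k l (+ 0) (+ 0) (*-identityˡ 1#))) u≈+) ⟩
      1# - 1#                   ≈⟨ -‿inverseʳ 1# ⟩
      0#                        ∎))

  -- Descent on ∣i∣ + ∣j∣, bounded by `n`. An odd exponent is impossible, and two even exponents are
  -- halved. The sign is universally quantified because the halved relation may have the other sign.
  independentUpTo : ∀ n i j σ → ∣ i ∣ ℕ.+ ∣ j ∣ ℕ.≤ n → unit i j ≈ ± σ → Trivial i j
  independentUpTo zero i j σ bound _ =
    ℤ.∣i∣≡0⇒i≡0 (ℕ.m+n≡0⇒m≡0 _ (ℕ.n≤0⇒n≡0 bound)) ,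
    ℤ.∣i∣≡0⇒i≡0 (ℕ.m+n≡0⇒n≡0 (∣ i ∣) (ℕ.n≤0⇒n≡0 bound))
  independentUpTo (suc n) i j σ bound u≈± = byParity (parity i) (parity j)
    where
    transport : ∀ {i′ j′} → i ≡ i′ → j ≡ j′ → unit i′ j′ ≈ ± σ
    transport i≡ j≡ = trans (reflexive (≡.cong₂ unit (≡.sym i≡) (≡.sym j≡))) u≈±
    ∣2k∣ : ∀ {i} k → i ≡ + 0 ℤ.+ k ℤ.* + 2 → ∣ i ∣ ≡ ∣ k ∣ ℕ.+ ∣ k ∣
    ∣2k∣ k i≡ = ≡.trans (≡.cong ∣_∣ (≡.trans i≡ (ℤ.+-identityˡ (k ℤ.* + 2))))
      (≡.trans (ℤ.abs-* k (+ 2)) (≡.trans (ℕ.*-comm (∣ k ∣) 2) (≡.cong (∣ k ∣ ℕ.+_) (ℕ.+-identityʳ _))))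
    half : ∀ {m n} → m ℕ.+ m ℕ.≤ suc n → m ℕ.≤ n
    half {zero}  _            = z≤n
    half {suc m} (s≤s m+sm≤n) = ℕ.≤-trans (ℕ.m≤n+m (suc m) m) m+sm≤n
    smaller : ∀ k l → i ≡ + 0 ℤ.+ k ℤ.* + 2 → j ≡ + 0 ℤ.+ l ℤ.* + 2 → ∣ k ∣ ℕ.+ ∣ l ∣ ℕ.≤ n
    smaller k l i≡ j≡ = half (≡.subst (ℕ._≤ suc n)
      (≡.trans (≡.cong₂ ℕ._+_ (∣2k∣ k i≡) (∣2k∣ l j≡)) (interchange (∣ k ∣) (∣ k ∣) (∣ l ∣) (∣ l ∣))) bound)
      where
      open CommutativeSemigroup ℕ.+-commutativeSemigroup using (interchange)
    double : ∀ {i k} → i ≡ + 0 ℤ.+ k ℤ.* + 2 → k ≡ + 0 → i ≡ + 0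
    double i≡ ≡.refl = i≡
    byParity : (∃ λ k → i ≡ + 0 ℤ.+ k ℤ.* + 2) ⊎ (∃ λ k → i ≡ + 1 ℤ.+ k ℤ.* + 2) →
               (∃ λ l → j ≡ + 0 ℤ.+ l ℤ.* + 2) ⊎ (∃ λ l → j ≡ + 1 ℤ.+ l ℤ.* + 2) → Trivial i j
    byParity (inj₁ (k , i≡)) (inj₁ (l , j≡)) =
      let (k≡0 , l≡0) = square-trivial k l
            (λ τ → independentUpTo n k l τ (smaller k l i≡ j≡)) σ (transport i≡ j≡)
      in double i≡ k≡0 , double j≡ l≡0
    byParity (inj₁ (k , i≡)) (inj₂ (l , j≡)) =
      contradiction (transport i≡ j≡) (evenTimes≉± (+ 0) (+ 1) γ̂ unit-01 k l σ)
    byParity (inj₂ (k , i≡)) (inj₁ (l , j≡)) =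
      contradiction (transport i≡ j≡) (evenTimes≉± (+ 1) (+ 0) α̂ unit-10 k l σ)
    byParity (inj₂ (k , i≡)) (inj₂ (l , j≡)) =
      contradiction (transport i≡ j≡) (evenTimes≉± (+ 1) (+ 1) αγ̂ unit-11 k l σ)

  independent : ∀ i j σ → unit i j ≈ ± σ → Trivial i j
  independent i j σ = independentUpTo _ i j σ ℕ.≤-refl

-- Chip firing and its termination

module ChipFiring where

  open ≡

  module _ {A : Set} where

    ∈⇒↭∷ : ∀ {x : A} {xs} → x List.∈ xs → ∃ λ ys → xs ↭ x ∷ ys
    ∈⇒↭∷ (here refl) = _ , ↭-refl
    ∈⇒↭∷ {x} {y ∷ _} (there x∈xs) =
      let (ys , xs↭) = ∈⇒↭∷ x∈xs in y ∷ ys , ↭-trans (↭-prep y xs↭) (↭-swap y x ↭-refl)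

    Unique-resp-↭ : ∀ {xs ys : List A} → xs ↭ ys → Unique xs → Unique ys
    Unique-resp-↭ xs↭ys = SetoidPermutation.Unique-resp-↭ (setoid A) (↭⇒↭ₛ xs↭ys)

    Triplicate Multiplicity≤2 : Pred (List A) _
    Triplicate xs = ∃₂ λ x ys → xs ↭ x ∷ x ∷ x ∷ ys
    Multiplicity≤2 xs = ∃₂ λ doubles singles → Unique (doubles ++ singles) × xs ↭ doubles ++ doubles ++ singles

    module _ (_≟_ : DecidableEquality A) where

      open DecMembership _≟_ using (_∈?_)

      -- Induction on the list: a new element completes a triple if it is already a double, turns a
      -- single into a double, and otherwise becomes a new single.
      triplicate? : ∀ xs → Triplicate xs ⊎ Multiplicity≤2 xs
      triplicate? [] = inj₂ ([] , [] , [] , ↭-refl)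
      triplicate? (x ∷ xs) with triplicate? xs
      ... | inj₁ (y , ys , xs↭) =
        inj₁ (y , x ∷ ys , ↭-trans (↭-prep x xs↭) (↭-sym (shift x (y ∷ y ∷ y ∷ []) ys)))
      ... | inj₂ (ds , ss , unique , xs↭) with x ∈? ds | x ∈? ss
      ...   | yes x∈ds | _ =
        let (ds′ , ds↭) = ∈⇒↭∷ x∈ds in
        inj₁ (x , ds′ ++ ds′ ++ ss , ↭-prep x (↭-trans xs↭
          (↭-trans (++⁺ ds↭ (++⁺ ds↭ ↭-refl)) (↭-prep x (shift x ds′ (ds′ ++ ss))))))
      ...   | no _ | yes x∈ss =
        let (ss′ , ss↭) = ∈⇒↭∷ x∈ss
            move : ds ++ ss ↭ x ∷ ds ++ ss′
            move = ↭-trans (++⁺ˡ ds ss↭) (shift x ds ss′)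
        in inj₂ (x ∷ ds , ss′ , Unique-resp-↭ move unique ,
                 ↭-prep x (↭-trans xs↭ (++⁺ˡ ds move)))
      ...   | no x∉ds | no x∉ss =
        inj₂ (ds , x ∷ ss , Unique-resp-↭ (↭-sym (shift x ds ss)) (All.¬Any⇒All¬ _ x∉ ∷ unique) ,
              ↭-trans (↭-prep x xs↭) (↭-sym (↭-trans (++⁺ˡ ds (shift x ds ss)) (shift x ds (ds ++ ss)))))
        where
        x∉ : ¬ (x List.∈ ds ++ ss)
        x∉ x∈ with ∈-++⁻ ds x∈
        ... | inj₁ x∈ds = x∉ds x∈ds
        ... | inj₂ x∈ss = x∉ss x∈ss

  -- (h , k , t) is the site of ± (α²γ⁻¹)ʰ (α⁻¹γ⁻¹)ᵏ αᵗ.  Firing multiplies the unit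
  -- by α⁻¹γ⁻¹ (up), α²γ⁻¹ (right) and α⁻¹γ² (left).
  Site : Set
  Site = ℤ × ℤ × Fin 3

  _≟ˢ_ : DecidableEquality Site
  _≟ˢ_ = Product.≡-dec ℤ._≟_ (Product.≡-dec ℤ._≟_ Fin._≟_)

  up right left : Site → Site
  up    (h , k , t) = h , k ℤ.+ + 1 , t
  right (h , k , t) = h ℤ.+ + 1 , k , t
  left  (h , k , t) = h ℤ.- + 1 , k ℤ.- + 1 , t

  height : Site → ℕ
  height (h , _ , _) = ∣ h ∣

  energy : List Site → ℕ
  energy = ℕ.sum ∘ map (λ s → height s ℕ.* height s)

  energy-↭ : ∀ {xs ys} → xs ↭ ys → energy xs ≡ energy ys
  energy-↭ = sum-↭ ∘ map⁺ _

  ∣i∣²≡i² : ∀ i → + (∣ i ∣ ℕ.* ∣ i ∣) ≡ i ℤ.* i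
  ∣i∣²≡i² (+ n)    = ℤ.pos-* n n
  ∣i∣²≡i² -[1+ n ] = refl

  -- (h + 1)² + (h - 1)² = 2h² + 2, and `up` leaves h alone.
  energy-fire : ∀ s xs → energy (up s ∷ right s ∷ left s ∷ xs) ≡ 2 ℕ.+ energy (s ∷ s ∷ s ∷ xs)
  energy-fire (h , _) xs = ℤ.+-injective (begin
    + (∣ h ∣ ℕ.* ∣ h ∣ ℕ.+ (∣ h ℤ.+ + 1 ∣ ℕ.* ∣ h ℤ.+ + 1 ∣ ℕ.+
      (∣ h ℤ.- + 1 ∣ ℕ.* ∣ h ℤ.- + 1 ∣ ℕ.+ energy xs)))
      ≡⟨ cong₂ ℤ._+_ (∣i∣²≡i² h) (cong₂ ℤ._+_ (∣i∣²≡i² (h ℤ.+ + 1)) (cong (ℤ._+ _) (∣i∣²≡i² (h ℤ.- + 1)))) ⟩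
    h ℤ.* h ℤ.+ ((h ℤ.+ + 1) ℤ.* (h ℤ.+ + 1) ℤ.+ ((h ℤ.- + 1) ℤ.* (h ℤ.- + 1) ℤ.+ + energy xs))
      ≡⟨ solve 2 (λ h e → let 1′ = con (+ 1) in
           h :* h :+ ((h :+ 1′) :* (h :+ 1′) :+ ((h :- 1′) :* (h :- 1′) :+ e))
           := con (+ 2) :+ (h :* h :+ (h :* h :+ (h :* h :+ e)))) refl h (+ energy xs) ⟩
    + 2 ℤ.+ (h ℤ.* h ℤ.+ (h ℤ.* h ℤ.+ (h ℤ.* h ℤ.+ + energy xs)))
      ≡⟨ cong (ℤ._+_ (+ 2)) (cong₂ ℤ._+_ (∣i∣²≡i² h) (cong₂ ℤ._+_ (∣i∣²≡i² h) (cong (ℤ._+ _) (∣i∣²≡i² h)))) ⟨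
    + (2 ℕ.+ (∣ h ∣ ℕ.* ∣ h ∣ ℕ.+ (∣ h ∣ ℕ.* ∣ h ∣ ℕ.+ (∣ h ∣ ℕ.* ∣ h ∣ ℕ.+ energy xs)))) ∎)
    where
    open ≡-Reasoning
    open +-*-Solver

  Gapless : List Site → Set
  Gapless xs = ∀ {s} → s List.∈ xs → ∀ {m} → m ℕ.≤ height s → Any (λ s′ → height s′ ≡ m) xs

  Gapless-resp-↭ : Gapless Respects _↭_
  Gapless-resp-↭ xs↭ys gapless s∈ys m≤ =
    Any-resp-↭ xs↭ys (gapless (Any-resp-↭ (↭-sym xs↭ys) s∈ys) m≤)

  -- The site s stays occupied at its own height by up s.
  Gapless-fire : ∀ s xs → Gapless (s ∷ s ∷ s ∷ xs) → Gapless (up s ∷ right s ∷ left s ∷ xs)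
  Gapless-fire s@(h , _) xs gapless = λ where
      (here refl) m≤                        → keep (gapless (here refl) m≤)
      (there (here refl)) m≤                → neighbour (there (here refl)) (ℤ.∣i+j∣≤∣i∣+∣j∣ h (+ 1)) m≤
      (there (there (here refl))) m≤        → neighbour (there (there (here refl))) (ℤ.∣i-j∣≤∣i∣+∣j∣ h (+ 1)) m≤
      (there (there (there s′∈xs))) m≤      → keep (gapless (there (there (there s′∈xs))) m≤)
    where
    fired = up s ∷ right s ∷ left s ∷ xs
    keep : ∀ {m} → Any (λ s′ → height s′ ≡ m) (s ∷ s ∷ s ∷ xs) → Any (λ s′ → height s′ ≡ m) fired
    keep (here eq)                         = here eq
    keep (there (here eq))                 = here eq
    keep (there (there (here eq)))         = here eq
    keep (there (there (there any)))       = there (there (there any))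
    neighbour : ∀ {s′} → s′ List.∈ fired → height s′ ℕ.≤ height s ℕ.+ 1 →
                ∀ {m} → m ℕ.≤ height s′ → Any (λ s″ → height s″ ≡ m) fired
    neighbour {s′} s′∈ bound {m} m≤ with ℕ.m≤n⇒m<n∨m≡n m≤
    ... | inj₂ refl = Any.map (λ { refl → refl }) s′∈
    ... | inj₁ m<   = keep (gapless (here refl)
      (ℕ.≤-pred (ℕ.≤-trans m< (ℕ.≤-trans bound (ℕ.≤-reflexive (ℕ.+-comm (height s) 1))))))

  -- Picking a chip of height m for every m up to the height of `s` injects `Fin (suc (height s))`
  -- into the positions of `xs`, since chips of different heights occupy different positions.
  height≤length : ∀ {xs} → Gapless xs → All (λ s → height s ℕ.≤ length xs) xs
  height≤length {xs} gapless = All.tabulate λ {s} s∈xs →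
    let occupied : (m : Fin (suc (height s))) → Any (λ s′ → height s′ ≡ toℕ m) xs
        occupied m = gapless s∈xs (ℕ.≤-pred (Fin.toℕ<n m))
    in ℕ.<⇒≤ (Fin.injective⇒≤ {f = λ m → Any.index (occupied m)} λ {m} {n} eq →
         Fin.toℕ-injective (trans (sym (lookup-index (occupied m)))
           (trans (cong (height ∘ lookup xs) eq) (lookup-index (occupied n)))))

  energy≤ : ∀ {n} xs → All (λ s → height s ℕ.≤ n) xs → energy xs ℕ.≤ length xs ℕ.* (n ℕ.* n)
  energy≤ []       []             = z≤n
  energy≤ (s ∷ xs) (s≤n ∷ xs≤n) = ℕ.+-mono-≤ (ℕ.*-mono-≤ s≤n s≤n) (energy≤ xs xs≤n)

  module _ {p} (P : Pred (List Site) p) (P-resp-↭ : P Respects _↭_)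
           (P-fire : ∀ s xs → P (s ∷ s ∷ s ∷ xs) → P (up s ∷ right s ∷ left s ∷ xs)) where

    -- Firing keeps the number of chips, hence also `maxEnergy`, and raises the energy by 2. The
    -- fuel bounds the remaining gap between the two. `P` is any invariant of firing.
    stabilise : ∀ xs → Gapless xs → P xs → ∃ λ ys → Multiplicity≤2 ys × P ys
    stabilise xs = go (maxEnergy xs) xs (ℕ.m≤m+n (maxEnergy xs) (energy xs))
      where
      -- With n chips, each has height at most n, so the energy is at most n · n².
      maxEnergy : List Site → ℕ
      maxEnergy xs = length xs ℕ.* (length xs ℕ.* length xs)
      go : ∀ fuel xs → maxEnergy xs ℕ.≤ fuel ℕ.+ energy xs → Gapless xs → P xs →
           ∃ λ ys → Multiplicity≤2 ys × P ys
      go fuel xs bound gapless pxs with triplicate? _≟ˢ_ xs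
      ... | inj₂ multiplicity≤2 = xs , multiplicity≤2 , pxs
      ... | inj₁ (s , ys , xs↭) = continue fuel bound
        where
        fired = up s ∷ right s ∷ left s ∷ ys
        gapless′ : Gapless fired
        gapless′ = Gapless-fire s ys (Gapless-resp-↭ xs↭ gapless)
        energy≡ : energy fired ≡ 2 ℕ.+ energy xs
        energy≡ = trans (energy-fire s ys) (cong (2 ℕ.+_) (energy-↭ (↭-sym xs↭)))
        maxEnergy≡ : maxEnergy fired ≡ maxEnergy xs
        maxEnergy≡ = cong (λ n → n ℕ.* (n ℕ.* n)) (sym (↭-length xs↭))
        continue : ∀ fuel → maxEnergy xs ℕ.≤ fuel ℕ.+ energy xs → ∃ λ ys → Multiplicity≤2 ys × P ys
        -- Without fuel the energy has already reached its bound, yet one more firing would raise it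
        -- by 2 under the same bound.
        continue zero bound = contradiction
          (ℕ.≤-trans (energy≤ fired (height≤length gapless′)) (ℕ.≤-trans (ℕ.≤-reflexive maxEnergy≡) bound))
          (ℕ.<⇒≱ (ℕ.≤-trans (ℕ.n≤1+n _) (ℕ.≤-reflexive (sym energy≡))))
        continue (suc fuel) bound = go fuel fired (begin
          maxEnergy fired                ≡⟨ maxEnergy≡ ⟩
          maxEnergy xs                   ≤⟨ bound ⟩
          suc fuel ℕ.+ energy xs         ≡⟨ ℕ.+-suc fuel (energy xs) ⟨
          fuel ℕ.+ suc (energy xs)       ≤⟨ ℕ.+-monoʳ-≤ fuel (ℕ.n≤1+n _) ⟩
          fuel ℕ.+ (2 ℕ.+ energy xs)     ≡⟨ cong (fuel ℕ.+_) energy≡ ⟨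
          fuel ℕ.+ energy fired          ∎)
          gapless′ (P-fire s ys (P-resp-↭ xs↭ pxs))
          where open ℕ.≤-Reasoning

open ChipFiring

-- Exponents of α and γ at a site

αExponent γExponent : Site → ℤ
αExponent (h , k , t) = (+ 2 ℤ.* h ℤ.- k) ℤ.+ + toℕ t
γExponent (h , k , t) = ℤ.- h ℤ.- k

-- The difference of the two exponents is 3h + t with 0 ≤ t ≤ 2, so it determines h and t by
-- division with remainder, and the exponent of γ then determines k. The argument first bounds 3∣h -
-- h′∣ by 2, which forces h = h′.
exponents-injective : ∀ s s′ → αExponent s ≡ αExponent s′ → γExponent s ≡ γExponent s′ → s ≡ s′
exponents-injective s@(h , k , t) s′@(h′ , k′ , t′) i≡i′ j≡j′ =
  ≡.cong₂ _,_ h≡h′ (≡.cong₂ _,_ k≡k′ (Fin.toℕ-injective (ℤ.+-injective t≡t′)))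
  where
  open ≡.≡-Reasoning
  open +-*-Solver
  difference≤2 : ∀ (t t′ : Fin 3) → ∣ + toℕ t ℤ.- + toℕ t′ ∣ ≤ 2
  difference≤2 = from-yes (Fin.all? λ (t : Fin 3) → Fin.all? λ (t′ : Fin 3) →
    ∣ + toℕ t ℤ.- + toℕ t′ ∣ ℕ.≤? 2)
  3Δh : + 3 ℤ.* (h ℤ.- h′) ≡ + toℕ t′ ℤ.- + toℕ t
  3Δh = begin
    + 3 ℤ.* (h ℤ.- h′)
      ≡⟨ solve 6 (λ h k t h′ k′ t′ → con (+ 3) :* (h :- h′) :=
           ((con (+ 2) :* h :- k) :+ t) :- (:- h :- k)
           :- (((con (+ 2) :* h′ :- k′) :+ t′) :- (:- h′ :- k′)) :+ (t′ :- t))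
           ≡.refl h k (+ toℕ t) h′ k′ (+ toℕ t′) ⟩
    αExponent s ℤ.- γExponent s ℤ.- (αExponent s′ ℤ.- γExponent s′) ℤ.+ (+ toℕ t′ ℤ.- + toℕ t)
      ≡⟨ ≡.cong₂ (λ i j → i ℤ.- j ℤ.- (αExponent s′ ℤ.- γExponent s′) ℤ.+ (+ toℕ t′ ℤ.- + toℕ t)) i≡i′ j≡j′ ⟩
    αExponent s′ ℤ.- γExponent s′ ℤ.- (αExponent s′ ℤ.- γExponent s′) ℤ.+ (+ toℕ t′ ℤ.- + toℕ t)
      ≡⟨ solve 2 (λ x y → x :- x :+ y := y) ≡.refl (αExponent s′ ℤ.- γExponent s′) (+ toℕ t′ ℤ.- + toℕ t) ⟩
    + toℕ t′ ℤ.- + toℕ t ∎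
  3∣Δh∣≤2 : 3 ℕ.* ∣ h ℤ.- h′ ∣ ≤ 2
  3∣Δh∣≤2 = ℕ.≤-trans
    (ℕ.≤-reflexive (≡.trans (≡.sym (ℤ.abs-* (+ 3) (h ℤ.- h′))) (≡.cong ∣_∣ 3Δh)))
    (difference≤2 t′ t)
  3m≤2⇒m≡0 : ∀ {m} → 3 ℕ.* m ≤ 2 → m ≡ 0
  3m≤2⇒m≡0 {zero}  _  = ≡.refl
  3m≤2⇒m≡0 {suc m} le =
    contradiction (ℕ.≤-trans (ℕ.*-monoʳ-≤ 3 (s≤s (z≤n {m}))) le) λ { (s≤s (s≤s ())) }
  h≡h′ : h ≡ h′
  h≡h′ = ℤ.i-j≡0⇒i≡j h h′ (ℤ.∣i∣≡0⇒i≡0 (3m≤2⇒m≡0 3∣Δh∣≤2))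
  k≡k′ : k ≡ k′
  k≡k′ = begin
    k                              ≡⟨ solve 2 (λ h k → k := :- h :- (:- h :- k)) ≡.refl h k ⟩
    ℤ.- h ℤ.- γExponent s          ≡⟨ ≡.cong₂ (λ h j → ℤ.- h ℤ.- j) h≡h′ j≡j′ ⟩
    ℤ.- h′ ℤ.- γExponent s′        ≡⟨ solve 2 (λ h k → k := :- h :- (:- h :- k)) ≡.refl h′ k′ ⟨
    k′                             ∎
  t≡t′ : + toℕ t ≡ + toℕ t′
  t≡t′ = begin
    + toℕ t
      ≡⟨ solve 3 (λ h k t → t := ((con (+ 2) :* h :- k) :+ t) :- (con (+ 2) :* h :- k)) ≡.refl
           h k (+ toℕ t) ⟩
    αExponent s ℤ.- (+ 2 ℤ.* h ℤ.- k)
      ≡⟨ ≡.cong₂ ℤ._-_ i≡i′ (≡.cong₂ (λ h k → + 2 ℤ.* h ℤ.- k) h≡h′ k≡k′) ⟩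
    αExponent s′ ℤ.- (+ 2 ℤ.* h′ ℤ.- k′)
      ≡⟨ solve 3 (λ h k t → t := ((con (+ 2) :* h :- k) :+ t) :- (con (+ 2) :* h :- k)) ≡.refl
           h′ k′ (+ toℕ t′) ⟨
    + toℕ t′ ∎

exponents-up : ∀ s →
  (αExponent (up s) ≡ αExponent s ℤ.+ -[1+ 0 ]) ×
  (γExponent (up s) ≡ γExponent s ℤ.+ -[1+ 0 ])
exponents-up (h , k , t) =
  solve 3 (λ h k t →
    (con (+ 2) :* h :- (k :+ con (+ 1))) :+ t :=
    ((con (+ 2) :* h :- k) :+ t) :+ con -[1+ 0 ]) ≡.refl h k (+ toℕ t) ,
  solve 2 (λ h k → :- h :- (k :+ con (+ 1)) := (:- h :- k) :+ con -[1+ 0 ]) ≡.refl h k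
  where open +-*-Solver

exponents-right : ∀ s →
  (αExponent (right s) ≡ αExponent s ℤ.+ + 2) ×
  (γExponent (right s) ≡ γExponent s ℤ.+ -[1+ 0 ])
exponents-right (h , k , t) =
  solve 3 (λ h k t →
    (con (+ 2) :* (h :+ con (+ 1)) :- k) :+ t :=
    ((con (+ 2) :* h :- k) :+ t) :+ con (+ 2)) ≡.refl h k (+ toℕ t) ,
  solve 2 (λ h k → :- (h :+ con (+ 1)) :- k := (:- h :- k) :+ con -[1+ 0 ]) ≡.refl h k
  where open +-*-Solver

exponents-left : ∀ s →
  (αExponent (left s) ≡ αExponent s ℤ.+ -[1+ 0 ]) ×
  (γExponent (left s) ≡ γExponent s ℤ.+ + 2)
exponents-left (h , k , t) =
  solve 3 (λ h k t →
    (con (+ 2) :* (h :- con (+ 1)) :- (k :- con (+ 1))) :+ t :=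
    ((con (+ 2) :* h :- k) :+ t) :+ con -[1+ 0 ]) ≡.refl h k (+ toℕ t) ,
  solve 2 (λ h k → :- (h :- con (+ 1)) :- (k :- con (+ 1)) := (:- h :- k) :+ con (+ 2)) ≡.refl h k
  where open +-*-Solver

-- Lists of sites with coefficients 1 and 2

AllPairs-lookup : ∀ {a r} {A : Set a} {R : A → A → Set r} {xs} → AllPairs R xs →
                  ∀ {i j} → i Fin.< j → R (lookup xs i) (lookup xs j)
AllPairs-lookup (Rx ∷ _)   {zero}  {suc j} _         = All.lookup Rx (∈-lookup j)
AllPairs-lookup (_ ∷ rest) {suc i} {suc j} (s≤s i<j) = AllPairs-lookup rest i<j

OneOrTwo : ℕ → Set
OneOrTwo c = c ≡ 1 ⊎ c ≡ 2

Entry : Set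
Entry = ℕ × Site

-- Joins the two conditions on a representation, decreasing coefficients and distinct terms, so that
-- one `AllPairs` proof yields both.
Descending : Entry → Entry → Set
Descending (c , s) (c′ , s′) = c′ ≤ c × s ≢ s′

Descending⇒antitone : ∀ es → AllPairs Descending es →
  ∀ {i j} → i Fin.≤ j → proj₁ (lookup es j) ≤ proj₁ (lookup es i)
Descending⇒antitone es descending i≤j with ℕ.m≤n⇒m<n∨m≡n i≤j
... | inj₁ i<j = proj₁ (AllPairs-lookup descending i<j)
... | inj₂ i≡j = ℕ.≤-reflexive (≡.cong (λ i → proj₁ (lookup es i)) (≡.sym (Fin.toℕ-injective i≡j)))

Descending⇒injective : ∀ es → AllPairs Descending es →
  ∀ {i j} → i ≢ j → proj₂ (lookup es i) ≢ proj₂ (lookup es j)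
Descending⇒injective es descending {i} {j} i≢j with Fin.<-cmp i j
... | tri< i<j _ _ = proj₂ (AllPairs-lookup descending i<j)
... | tri≈ _ i≡j _ = contradiction i≡j i≢j
... | tri> _ _ j<i = λ eq → proj₂ (AllPairs-lookup descending j<i) (≡.sym eq)

OneOrTwo⇒≤2 : ∀ {n} → OneOrTwo n → n ≤ 2
OneOrTwo⇒≤2 (inj₁ ≡.refl) = s≤s z≤n
OneOrTwo⇒≤2 (inj₂ ≡.refl) = ℕ.≤-refl

OneOrTwo⇒positive : ∀ {n} → OneOrTwo n → 0 ℕ.< n
OneOrTwo⇒positive (inj₁ ≡.refl) = s≤s z≤n
OneOrTwo⇒positive (inj₂ ≡.refl) = s≤s z≤n

≤⁺2⇒≤⁺1⊎≡2 : ∀ {v} → v ≤⁺ [ 2 ] → v ≤⁺ [ 1 ] ⊎ v ≡ [ 2 ]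
≤⁺2⇒≤⁺1⊎≡2 [ v≤2 ] with ℕ.m≤n⇒m<n∨m≡n v≤2
... | inj₁ (s≤s v≤1) = inj₁ [ v≤1 ]
... | inj₂ ≡.refl    = inj₂ ≡.refl

-- The doubles come first, so that the coefficients decrease along the list.
weighted : List Site → List Site → List Entry
weighted doubles singles = map (2 ,_) doubles ++ map (1 ,_) singles

weighted-OneOrTwo : ∀ ds ss → All (λ e → OneOrTwo (proj₁ e)) (weighted ds ss)
weighted-OneOrTwo []       ss = All.map⁺ (All.universal (λ _ → inj₁ ≡.refl) ss)
weighted-OneOrTwo (d ∷ ds) ss = inj₂ ≡.refl ∷ weighted-OneOrTwo ds ss

weighted-Descending : ∀ ds ss → Unique (ds ++ ss) → AllPairs Descending (weighted ds ss)
weighted-Descending [] ss unique = AllPairs.map⁺ (AllPairs.map (λ s≢ → ℕ.≤-refl , s≢) unique)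
weighted-Descending (d ∷ ds) ss (d∉ ∷ unique) =
  All.++⁺ (All.map⁺ (All.map (λ d≢ → ℕ.≤-refl , d≢) (All.++⁻ˡ ds d∉)))
          (All.map⁺ (All.map (λ d≢ → s≤s z≤n , d≢) (All.++⁻ʳ ds d∉)))
  ∷ weighted-Descending ds ss unique

-- Expansion of elements into units

module Expansion {c ℓ₁ ℓ₂} (F : HeytingField c ℓ₁ ℓ₂) (char0 : CharacteristicZero F)
            (a : ℤ) (α : HeytingField.Carrier F) (isRoot : IsRoot F a α) where

  open IndependentUnits F char0 a α isRoot
  open RawSemiringDefinitions (Semiring.rawSemiring semiring) using (sum) renaming (_×_ to _·_)

  R = ℤ[_] F α

  -- This is 1 + α³ + γ³ = 3αγ, a consequence of 1 + α + γ = 0, divided by αγ.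
  firing-identity : unit -[1+ 0 ] -[1+ 0 ] + unit (+ 2) -[1+ 0 ] + unit -[1+ 0 ] (+ 2) ≈ ι (+ 3)
  firing-identity = begin
    (α⁻¹ * 1#) * (γ⁻¹ * 1#) + (α * (α * 1#)) * (γ⁻¹ * 1#) + (α⁻¹ * 1#) * (γ * (γ * 1#))
      ≈⟨ solve 4 (λ x y u v → let 1′ = con (+ 1) in
           (u :* 1′) :* (v :* 1′) :+ (x :* (x :* 1′)) :* (v :* 1′) :+ (u :* 1′) :* (y :* (y :* 1′)) :=
           u :* v :+ 1′ :* (x :* x :* v) :+ 1′ :* (u :* y :* y)) refl α γ α⁻¹ γ⁻¹ ⟩
    α⁻¹ * γ⁻¹ + 1# * (α * α * γ⁻¹) + 1# * (α⁻¹ * γ * γ)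
      -- The inserted factors α α⁻¹ and γ γ⁻¹ give all three terms the common factor α⁻¹γ⁻¹, with 1,
      -- α³ and γ³ left over.
      ≈⟨ +-cong (+-congˡ (*-congʳ αα⁻¹≈1)) (*-congʳ γγ⁻¹≈1) ⟨
    α⁻¹ * γ⁻¹ + (α * α⁻¹) * (α * α * γ⁻¹) + (γ * γ⁻¹) * (α⁻¹ * γ * γ)
      ≈⟨ solve 4 (λ x y u v → let 1′ = con (+ 1) in
           u :* v :+ (x :* u) :* (x :* x :* v) :+ (y :* v) :* (u :* y :* y) :=
           con (+ 3) :* (x :* u) :* (y :* v) :+
           (y :- (:- 1′ :- x)) :* (u :* v :* (1′ :+ x :* x :+ y :* y :- x :- y :- x :* y)))
           refl α γ α⁻¹ γ⁻¹ ⟩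
    ι (+ 3) * (α * α⁻¹) * (γ * γ⁻¹) + (γ - (- 1# - α)) * cofactor
      ≈⟨ +-cong (*-cong (*-congˡ αα⁻¹≈1) γγ⁻¹≈1) (*-congʳ (trans (+-congʳ γ≈-1-α) (-‿inverseʳ _))) ⟩
    ι (+ 3) * 1# * 1# + 0# * cofactor
      ≈⟨ +-cong (trans (*-identityʳ _) (*-identityʳ _)) (zeroˡ cofactor) ⟩
    ι (+ 3) + 0#
      ≈⟨ +-identityʳ _ ⟩
    ι (+ 3) ∎
    where
    -- The second factor in 1 + x³ + y³ - 3xy = (1 + x + y)(1 + x² + y² - x - y - xy), times α⁻¹γ⁻¹.
    cofactor = α⁻¹ * γ⁻¹ * (1# + α * α + γ * γ - α - γ - α * γ)

  -- The moves generate a sublattice of index 3 in the exponent lattice, and `t` names the coset.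
  -- Firing preserves `t`, so a sign chosen once for each `t` stays attached to its chips, and chips
  -- of opposite sign never share a site.
  module Signed (sgn : Fin 3 → Sign) where

    value : Site → Carrier
    value s@(_ , _ , t) = ± (sgn t) * unit (αExponent s) (γExponent s)

    total : List Site → Carrier
    total = foldr (λ s x → value s + x) 0#

    value∈ : ∀ s → value s ∈ R
    value∈ s@(_ , _ , t) = *-closed (ι∈ (sgn t ◃ 1)) (unit∈ (αExponent s) (γExponent s))

    valueIsUnit : ∀ s → value s ∈ Units F R
    valueIsUnit s@(_ , _ , t) = value∈ s , ± (sgn t) * unit (ℤ.- i) (ℤ.- j) ,
      *-closed (ι∈ (sgn t ◃ 1)) (unit∈ (ℤ.- i) (ℤ.- j)) , (begin
      (± (sgn t) * unit i j) * (± (sgn t) * unit (ℤ.- i) (ℤ.- j))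
        ≈⟨ solve 3 (λ σ u v → (σ :* u) :* (σ :* v) := (σ :* σ) :* (u :* v)) refl
             (± (sgn t)) (unit i j) (unit (ℤ.- i) (ℤ.- j)) ⟩
      (± (sgn t) * ± (sgn t)) * (unit i j * unit (ℤ.- i) (ℤ.- j))
        ≈⟨ *-cong (±²≈1 (sgn t)) (unit-inverse i j) ⟩
      1# * 1#  ≈⟨ *-identityˡ 1# ⟩
      1#       ∎)
      where
      i = αExponent s
      j = γExponent s

    -- The quotient of two equal values shows that the unit with the difference exponents is the
    -- product of the two signs, that is ±1. Independence makes the differences vanish, and the
    -- exponents determine the site.
    value-injective : ∀ s s′ → value s ≈ value s′ → s ≡ s′
    value-injective s@(_ , _ , t) s′@(_ , _ , t′) eq =
      let (i≡ , j≡) = independent (i ℤ.- i′) (j ℤ.- j′) (sgn t Sign.* sgn t′) (begin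
            unit (i ℤ.- i′) (j ℤ.- j′)               ≈⟨ unit-+ i j (ℤ.- i′) (ℤ.- j′) ⟩
            unit i j * w                             ≈⟨ *-identityˡ _ ⟨
            1# * (unit i j * w)                      ≈⟨ *-congʳ (±²≈1 (sgn t)) ⟨
            (± (sgn t) * ± (sgn t)) * (unit i j * w)
              ≈⟨ solve 3 (λ σ u w → (σ :* σ) :* (u :* w) := σ :* w :* (σ :* u)) refl (± (sgn t)) (unit i j) w ⟩
            ± (sgn t) * w * value s                  ≈⟨ *-congˡ eq ⟩
            ± (sgn t) * w * (± (sgn t′) * unit i′ j′)
              ≈⟨ solve 4 (λ σ w τ u → σ :* w :* (τ :* u) := σ :* τ :* (u :* w)) refl
                   (± (sgn t)) w (± (sgn t′)) (unit i′ j′) ⟩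
            ± (sgn t) * ± (sgn t′) * (unit i′ j′ * w)  ≈⟨ *-congˡ (unit-inverse i′ j′) ⟩
            ± (sgn t) * ± (sgn t′) * 1#                ≈⟨ *-identityʳ _ ⟩
            ± (sgn t) * ± (sgn t′)                     ≈⟨ ±-* (sgn t) (sgn t′) ⟨
            ± (sgn t Sign.* sgn t′)                    ∎)
      in exponents-injective s s′ (ℤ.i-j≡0⇒i≡j i i′ i≡) (ℤ.i-j≡0⇒i≡j j j′ j≡)
      where
      i = αExponent s
      j = γExponent s
      i′ = αExponent s′
      j′ = γExponent s′
      w = unit (ℤ.- i′) (ℤ.- j′)

    value-fire : ∀ s → value (up s) + value (right s) + value (left s) ≈ ι (+ 3) * value s
    value-fire s@(_ , _ , t) = begin
      value (up s) + value (right s) + value (left s)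
        ≈⟨ +-cong (+-cong (*-congˡ (shifted (up s) (exponents-up s)))
                          (*-congˡ (shifted (right s) (exponents-right s))))
                  (*-congˡ (shifted (left s) (exponents-left s))) ⟩
      σ * (u * unit -[1+ 0 ] -[1+ 0 ]) + σ * (u * unit (+ 2) -[1+ 0 ]) + σ * (u * unit -[1+ 0 ] (+ 2))
        ≈⟨ solve 5 (λ σ u x y z →
             σ :* (u :* x) :+ σ :* (u :* y) :+ σ :* (u :* z) := (x :+ y :+ z) :* (σ :* u)) refl
             σ u (unit -[1+ 0 ] -[1+ 0 ]) (unit (+ 2) -[1+ 0 ]) (unit -[1+ 0 ] (+ 2)) ⟩
      (unit -[1+ 0 ] -[1+ 0 ] + unit (+ 2) -[1+ 0 ] + unit -[1+ 0 ] (+ 2)) * value s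
        ≈⟨ *-congʳ firing-identity ⟩
      ι (+ 3) * value s ∎
      where
      σ = ± (sgn t)
      u = unit (αExponent s) (γExponent s)
      shifted : ∀ s′ {Δi Δj} →
        (αExponent s′ ≡ αExponent s ℤ.+ Δi) × (γExponent s′ ≡ γExponent s ℤ.+ Δj) →
        unit (αExponent s′) (γExponent s′) ≈ u * unit Δi Δj
      shifted s′ {Δi} {Δj} (i≡ , j≡) =
        trans (reflexive (≡.cong₂ unit i≡ j≡)) (unit-+ (αExponent s) (γExponent s) Δi Δj)

    total-fire : ∀ s xs → total (s ∷ s ∷ s ∷ xs) ≈ total (up s ∷ right s ∷ left s ∷ xs)
    total-fire s xs = begin
      v + (v + (v + total xs))
        ≈⟨ solve 2 (λ v t → v :+ (v :+ (v :+ t)) := con (+ 3) :* v :+ t) refl v (total xs) ⟩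
      ι (+ 3) * v + total xs
        ≈⟨ +-congʳ (value-fire s) ⟨
      value (up s) + value (right s) + value (left s) + total xs
        ≈⟨ solve 4 (λ x y z t → x :+ y :+ z :+ t := x :+ (y :+ (z :+ t))) refl
             (value (up s)) (value (right s)) (value (left s)) (total xs) ⟩
      value (up s) + (value (right s) + (value (left s) + total xs)) ∎
      where v = value s

    total-↭ : ∀ {xs ys} → xs ↭ ys → total xs ≈ total ys
    total-↭ Permutation.refl          = refl
    total-↭ (Permutation.prep s p)    = +-congˡ (total-↭ p)
    total-↭ (Permutation.swap {xs} {ys} s t p)  = begin
      value s + (value t + total xs)  ≈⟨ +-assoc _ _ _ ⟨
      (value s + value t) + total xs  ≈⟨ +-cong (+-comm _ _) (total-↭ p) ⟩
      (value t + value s) + total ys  ≈⟨ +-assoc _ _ _ ⟩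
      value t + (value s + total ys)  ∎
    total-↭ (Permutation.trans p q)   = trans (total-↭ p) (total-↭ q)

    total-++ : ∀ xs ys → total (xs ++ ys) ≈ total xs + total ys
    total-++ []       ys = sym (+-identityˡ _)
    total-++ (x ∷ xs) ys = trans (+-congˡ (total-++ xs ys)) (sym (+-assoc _ _ _))

    total-replicate : ∀ n s → total (replicate n s) ≈ n · value s
    total-replicate zero    s = refl
    total-replicate (suc n) s = +-congˡ (total-replicate n s)

    weightedTotal : List Entry → Carrier
    weightedTotal = foldr (λ (c , s) x → c · value s + x) 0#

    weightedTotal-weighted : ∀ ds ss → weightedTotal (weighted ds ss) ≈ total (ds ++ ds ++ ss)
    weightedTotal-weighted ds ss = trans (go ds)
      (sym (trans (total-++ ds (ds ++ ss)) (+-congˡ (total-++ ds ss))))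
      where
      singles : ∀ ss → weightedTotal (map (1 ,_) ss) ≈ total ss
      singles []       = refl
      singles (s ∷ ss) = +-cong (+-identityʳ _) (singles ss)
      go : ∀ ds → weightedTotal (weighted ds ss) ≈ total ds + (total ds + total ss)
      go []       = trans (singles ss) (sym (trans (+-identityˡ _) (+-identityˡ _)))
      go (d ∷ ds) = trans (+-congˡ (go ds))
        (solve 3 (λ v t u → (v :+ (v :+ con (+ 0))) :+ (t :+ (t :+ u)) := (v :+ t) :+ ((v :+ t) :+ u)) refl
          (value d) (total ds) (total ss))

    weightedTotal-sum : ∀ es → weightedTotal es ≈ sum (λ i → proj₁ (lookup es i) · value (proj₂ (lookup es i)))
    weightedTotal-sum []       = refl
    weightedTotal-sum (e ∷ es) = +-congˡ (weightedTotal-sum es)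

    representation : ∀ {x} es → ¬ (x ≈ 0#) → x ≈ weightedTotal es →
      All (λ e → OneOrTwo (proj₁ e)) es → AllPairs Descending es →
      Σ (RepresentationByUnits F R x) λ ρ → ∀ i → OneOrTwo (Representation.coeff ρ i)
    -- A representation has at least one term. The empty list would give `x ≈ 0#`, which is
    -- excluded.
    representation []       x≉0 x≈ _ _ = contradiction x≈ x≉0
    representation {x} es@(_ ∷ es′) x≉0 x≈ oneOrTwo descending = record
      { ℓ-1        = length es′
      ; coeff      = coefficient
      ; ν          = λ i → value (site i)
      ; positive   = λ i → OneOrTwo⇒positive (coefficient∈ i)
      ; decreasing = Descending⇒antitone es descending
      ; ν∈Γ        = λ i → valueIsUnit (site i)
      ; ν∈R        = λ i → value∈ (site i)
      ; distinct   = λ {i} {j} i≢j νi≈νj →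
          Descending⇒injective es descending i≢j (value-injective (site i) (site j) νi≈νj)
      ; equation   = trans x≈ (weightedTotal-sum es)
      } , coefficient∈
      where
      coefficient : Fin (length es) → ℕ
      coefficient i = proj₁ (lookup es i)
      site : Fin (length es) → Site
      site i = proj₂ (lookup es i)
      coefficient∈ : ∀ i → OneOrTwo (coefficient i)
      coefficient∈ i = All.lookup oneOrTwo (∈-lookup i)

    represent : ∀ {x} xs → Gapless xs → ¬ (x ≈ 0#) → x ≈ total xs →
      Σ (RepresentationByUnits F R x) λ ρ → ∀ i → OneOrTwo (Representation.coeff ρ i)
    represent {x} xs gapless x≉0 x≈ =
      let (ys , (ds , ss , unique , ys↭) , x≈ys) =
            -- The invariant of firing is that the values of the chips add up to `x`.
            stabilise (λ zs → x ≈ total zs) (λ p eq → trans eq (total-↭ p))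
              (λ s zs eq → trans eq (total-fire s zs)) xs gapless x≈
      in representation (weighted ds ss) x≉0
           (trans x≈ys (trans (total-↭ ys↭) (sym (weightedTotal-weighted ds ss))))
           (weighted-OneOrTwo ds ss) (weighted-Descending ds ss unique)

  origin : Fin 3 → Site
  origin t = + 0 , + 0 , t

  -- The coordinates of `x` give the starting piles on 1, α and α². All their chips have height 0,
  -- so the configuration is gapless and can be stabilised.
  unitRepresentation : ∀ {x} → x ∈ R → ¬ (x ≈ 0#) →
    Σ (RepresentationByUnits F R x) λ ρ → ∀ i → OneOrTwo (Representation.coeff ρ i)
  unitRepresentation {x} x∈ x≉0 = represent chips gapless x≉0 (trans x≈s (sym total≈))
    where
    s = proj₁ (coordinates x∈)
    x≈s = proj₂ (coordinates x∈)
    coordinate : Fin 3 → ℤ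
    coordinate 0F = c₀ s
    coordinate 1F = c₁ s
    coordinate 2F = c₂ s
    -- A zero coordinate gets the sign + by default, which is harmless because its pile is empty.
    open Signed (λ t → sign (coordinate t))
    pile : Fin 3 → List Site
    pile t = replicate ∣ coordinate t ∣ (origin t)
    chips = pile 0F ++ pile 1F ++ pile 2F
    flat : All (λ s → height s ≡ 0) chips
    flat = All.++⁺ (All.replicate⁺ (∣ coordinate 0F ∣) ≡.refl)
             (All.++⁺ (All.replicate⁺ (∣ coordinate 1F ∣) ≡.refl) (All.replicate⁺ (∣ coordinate 2F ∣) ≡.refl))
    gapless : Gapless chips
    gapless s∈ m≤ = Any.map (λ { ≡.refl → ≡.trans (All.lookup flat s∈)
      (≡.sym (ℕ.n≤0⇒n≡0 (ℕ.≤-trans m≤ (ℕ.≤-reflexive (All.lookup flat s∈))))) }) s∈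
    sign◃1*∣n∣≡n : ∀ n → + ∣ n ∣ ℤ.* (sign n ◃ 1) ≡ n
    sign◃1*∣n∣≡n (+ n)    = ℤ.*-identityʳ (+ n)
    sign◃1*∣n∣≡n -[1+ n ] = ≡.trans (ℤ.*-comm (+ suc n) -[1+ 0 ]) (ℤ.-1*i≡-i (+ suc n))
    pile≈ : ∀ t → total (pile t) ≈ ι (coordinate t) * unit (+ toℕ t) (+ 0)
    pile≈ t = begin
      total (pile t)                                        ≈⟨ total-replicate (∣ n ∣) (origin t) ⟩
      ∣ n ∣ · value (origin t)                              ≈⟨ ·≈ι* (∣ n ∣) (value (origin t)) ⟩
      ι (+ ∣ n ∣) * (± (sign n) * unit (+ toℕ t) (+ 0))     ≈⟨ *-assoc _ _ _ ⟨
      (ι (+ ∣ n ∣) * ± (sign n)) * unit (+ toℕ t) (+ 0)     ≈⟨ *-congʳ (ι-* (+ ∣ n ∣) (sign n ◃ 1)) ⟨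
      ι (+ ∣ n ∣ ℤ.* (sign n ◃ 1)) * unit (+ toℕ t) (+ 0)
        ≡⟨ ≡.cong (λ m → ι m * unit (+ toℕ t) (+ 0)) (sign◃1*∣n∣≡n n) ⟩
      ι n * unit (+ toℕ t) (+ 0)                            ∎
      where n = coordinate t
    total≈ : total chips ≈ ev s
    total≈ = begin
      total chips
        ≈⟨ trans (total-++ (pile 0F) _) (+-congˡ (total-++ (pile 1F) (pile 2F))) ⟩
      total (pile 0F) + (total (pile 1F) + total (pile 2F))
        ≈⟨ +-cong (pile≈ 0F) (+-cong (pile≈ 1F) (pile≈ 2F)) ⟩
      ι (c₀ s) * (1# * 1#) + (ι (c₁ s) * ((α * 1#) * 1#) + ι (c₂ s) * ((α * (α * 1#)) * 1#))
        ≈⟨ solve 4 (λ p q r α → let 1′ = con (+ 1) in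
             p :* (1′ :* 1′) :+ (q :* ((α :* 1′) :* 1′) :+ r :* ((α :* (α :* 1′)) :* 1′)) :=
             p :+ q :* α :+ r :* (α :* α)) refl (ι (c₀ s)) (ι (c₁ s)) (ι (c₂ s)) α ⟩
      ev s ∎

  -- The value of ω for the order

  1≉0 : ¬ (1# ≈ 0#)
  1≉0 1≈0 = contradiction (ι≈0⇒≡0 (+ 1) 1≈0) λ ()

  -- The single term 1 · 1 has the least possible leading coefficient, as coefficients are positive.
  -- It shows that the maximum 1 is attained when no element has the value 2.
  omega1 : Omega F R (Units F R) 1# [ 1 ]
  omega1 = finite 1≉0 (ρ , ≡.refl) λ ρ → Representation.positive ρ 0F
    where
    open Signed (λ _ → Sign.+)
    ρ = proj₁ (representation ((1 , origin 0F) ∷ []) 1≉0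
          (solve 0 (con (+ 1) := con (+ 1) :* (con (+ 1) :* con (+ 1)) :+ con (+ 0) :+ con (+ 0)) refl)
          (inj₁ ≡.refl ∷ []) ([] ∷ []))

  OmegaTwo : Set _
  OmegaTwo = ∃ λ x → x ∈ R × Omega F R (Units F R) x [ 2 ]

  omega≤2 : ∀ {x} → x ∈ R → ∀ {v} → Omega F R (Units F R) x v → v ≤⁺ [ 2 ]
  omega≤2 x∈ (at-zero _) = [ z≤n ]
  omega≤2 x∈ (finite x≉0 _ minimal) =
    let (ρ , oneOrTwo) = unitRepresentation x∈ x≉0 in
    [ ℕ.≤-trans (minimal ρ) (OneOrTwo⇒≤2 (oneOrTwo 0F)) ]
  omega≤2 x∈ (infinite x≉0 none) = contradiction (proj₁ (unitRepresentation x∈ x≉0)) none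

  omega≤1 : ¬ OmegaTwo → ∀ {x} → x ∈ R → ∀ {v} → Omega F R (Units F R) x v → v ≤⁺ [ 1 ]
  omega≤1 ¬2 x∈ ω = case ≤⁺2⇒≤⁺1⊎≡2 (omega≤2 x∈ ω) of λ where
    (inj₁ v≤1)    → v≤1
    (inj₂ ≡.refl) → contradiction (_ , x∈ , ω) ¬2

  -- Whether ω equals 1 or 2 need not be decidable, hence the double negation.
  omega : ¬ ¬ (∃ λ m → IsOmegaOfOrder F R m × m ≤ 2)
  omega none = ¬two λ two → none (2 , (two , omega≤2) , ℕ.≤-refl)
    where
    ¬two : ¬ ¬ OmegaTwo
    ¬two ¬2 = none (1 , ((1# , 1#-mem , omega1) , omega≤1 ¬2) , s≤s z≤n)

theorem2 : ∀ {c ℓ₁ ℓ₂ : Level} (F : HeytingField c ℓ₁ ℓ₂) → CharacteristicZero F →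
    let open HeytingField F in
    (a : ℤ) (α : Carrier) → IsRoot F a α →
    (¬ ¬ (∃ λ (m : ℕ) → IsOmegaOfOrder F (ℤ[_] F α) m × m ≤ 2)) ×
    (∀ (x : Carrier) → x ∈ ℤ[_] F α → ¬ (x ≈ 0#) →
    Σ (RepresentationByUnits F (ℤ[_] F α) x) λ ρ →
    ∀ i → (Representation.coeff ρ i ≡ 1) ⊎ (Representation.coeff ρ i ≡ 2))
theorem2 F char0 a α isRoot = omega , λ x → unitRepresentation
  where open Expansion F char0 a α isRoot
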